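{- Let $D\ge 1$ and $N>2D$ be integers, let $q$ be a prime power, let $\Gamma=J_q(N,D)$, and let $x$ be a vertex of $\Gamma$. Let $W$ be an irreducible $T$-submodule of the nucleus $\mathcal{N}=\mathcal{N}(x)$ with endpoint $r$. Let $\Omega\subseteq\Psi$ be an irreducible $\mathcal{H}$-module that is alpha-dominant with gap $r$. Then the following are equivalent: (i) $\widetilde{\Omega}=W$; (ii) $\Omega=W^{\mathcal{H}}$.
   Context: Let $\mathbb{F}_q$ be a finite field with $q$ elements and $\mathcal{V}$ an $N$-dimensional vector space over $\mathbb{F}_q$. The Grassmann graph $\Gamma=J_q(N,D)$ has vertex set $X$ consisting of the $D$-dimensional subspaces of $\mathcal{V}$; $y,z\in X$ are adjacent iff $\dim(y\cap z)=D-1$. Let $\partial$ be the path-length distance; for $N>2D$ the diameter is $D$ and $\partial(y,z)=D-\dim(y\cap z)$. Put $[\ell]=\frac{q^\ell-1}{q-1}$. Terwilliger algebra and nucleus. Let $A\in\mathrm{Mat}_X(\mathbb{C})$ be the adjacency matrix of $\Gamma$ and $V=\mathbb{C}^X$. $A$ has exactly $D+1$ distinct eigenvalues $\theta_0>\cdots>\theta_D$, namely $\theta_i=q[D][N-D]-[i][N-i+1]$; let $E_i$ be the orthogonal projection of $V$ onto the $\theta_i$-eigenspace. For $0\le i\le D$ let $E_i^*$ be the diagonal matrix with $(y,y)$-entry $1$ if $\partial(x,y)=i$ and $0$ otherwise. $T=T(x)$ is the subalgebra of $\mathrm{Mat}_X(\mathbb{C})$ generated by $A,E_0^*,\dots,E_D^*$.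 A $T$-module is a subspace $W\subseteq V$ with $TW\subseteq W$; irreducible means nonzero with no $T$-submodule other than $0$ and $W$. An irreducible $T$-module $W$ has endpoint $r=\min\{i: E_i^*W\ne0\}$, dual endpoint $t=\min\{i: E_iW\neq 0\}$, diameter $d=|\{i: E_i^*W\ne 0\}|-1$, and displacement $r+t-D+d$. The nucleus $\mathcal{N}$ is the span of all irreducible $T$-modules with displacement $0$. The algebra $\mathcal{H}$. Let $P$ be the set of all subspaces of $\mathcal{V}$. For $0\le i\le D$, $0\le j\le N-D$ let $P_{i,j}=\{u\in P: \dim(u\cap x)=i,\ \dim u=i+j\}$; these sets partition $P$. For $u\subseteq v$ in $P$ with $\dim v=\dim u+1$ and $u\in P_{i,j}$: $v$ $/$-covers $u$ if $v\in P_{i+1,j}$, and $v$ $\backslash$-covers $u$ if $v\in P_{i,j+1}$ (exactly one holds). In $\mathrm{Mat}_P(\mathbb{C})$: $E^*_{i,j}$ is the diagonal projection onto coordinates in $P_{i,j}$; $K_1,K_2$ are diagonal with $(u,u)$-entries $q^{D/2-i}$, $q^{(N-D)/2-j}$ for $u\in P_{i,j}$; $L_1$ (resp. $L_2$) has $(u,v)$-entry $1$ if $v$ $/$-covers (resp. $\backslash$-covers) $u$ and $0$ otherwise; $R_1=L_1^\top$, $R_2=L_2^\top$. $\mathcal{H}=\mathcal{H}(x)$ is the subalgebra generated by $L_1,L_2,R_1,R_2,K_1^{\pm1},K_2^{\pm1}$. Let $\Psi=\mathbb{C}^P$; $\mathcal{H}$-modules are $\mathcal{H}$-invariant subspaces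 of $\Psi$, irreducible if nonzero with no $\mathcal{H}$-submodule other than $0$ and itself. For each irreducible $\mathcal{H}$-module $\Omega$ there are unique integers $\alpha,\beta,\rho$ with $\rho\ge0$, $0\le\alpha\le\frac{D-\rho}{2}$, $0\le\beta\le\frac{N-D-\rho}{2}$ such that for $0\le i\le D$, $0\le j\le N-D$, $\dim E^*_{i,j}\Omega=1$ if $\alpha\le i\le D-\rho-\alpha$ and $\rho+\beta\le j\le N-D-\beta$, and $\dim E^*_{i,j}\Omega=0$ otherwise. The triple $(\alpha,\beta,\rho)$ is the type of $\Omega$. $\Omega$ is alpha-dominant with gap $\alpha$ if it has type $(\alpha,0,0)$ with $0\le\alpha\le\frac D2$. Regard $V$ as the subspace $\sum_{j=0}^{D}E^*_{D-j,j}\Psi$ of $\Psi$ (vectors supported on $X\subseteq P$). For an $\mathcal{H}$-submodule $\Omega\subseteq\Psi$ let $\widetilde{\Omega}=\sum_{j=0}^{D}E^*_{D-j,j}\Omega\subseteq V$. For a $T$-module $W$, let $W^{\mathcal{H}}$ be the intersection of all $\mathcal{H}$-submodules $\Omega\subseteq\Psi$ with $\widetilde{\Omega}=W$. -}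

module Defs where

open import Algebra.Bundles using (CommutativeRing)
open import Algebra.Module.Bundles using (LeftModule)
open import Algebra.Module.Bundles.Raw using (RawLeftModule)
import Algebra.Definitions.RawMonoid as RawMonoidSum
import Algebra.Properties.Monoid.Sum as MonoidSum
open import Axiom.ExcludedMiddle using (ExcludedMiddle)
open import Data.Bool.Base using (if_then_else_)
open import Data.Empty using (⊥-elim)
open import Data.Fin.Base using (Fin; zero; suc; toℕ; finToFun; funToFin)
import Data.Fin.Properties as Fin
open import Data.Integer.Base using (ℤ; +_; -[1+_])
  renaming (_+_ to _+ℤ_; _-_ to _-ℤ_; -_ to -ℤ_; _*_ to _*ℤ_)
open import Data.List.Base as List using (List; length; lookup; filter; deduplicate; allFin; tabulate; upTo)
open import Data.List.Membership.Propositional using () renaming (_∈_ to _∈ˡ_)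
open import Data.List.Membership.Propositional.Properties using (∈-allFin; ∈-filter⁺; ∈-filter⁻; ∈-lookup)
import Data.List.Membership.Setoid.Properties as Membership
import Data.List.Relation.Unary.Any as Any
import Data.List.Relation.Unary.Any.Properties as Any
import Data.List.Relation.Unary.Unique.DecSetoid.Properties as Unique
import Data.List.Relation.Unary.Unique.Propositional.Properties as UniqueP
import Data.List.Relation.Unary.Unique.Setoid as UniqueSetoid
import Data.List.Relation.Unary.All as All
open import Data.List.Relation.Unary.AllPairs using ([]; _∷_)
open import Data.Nat.Base using (ℕ; zero; suc; _∸_)
  renaming (_+_ to _+ℕ_; _*_ to _*ℕ_; _^_ to _^ℕ_; _≤_ to _≤ℕ_)
open import Data.Nat.Primality using (Prime)
open import Data.Product using (Σ; ∃-syntax; ∃₂; _×_; _,_; proj₁; proj₂)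
open import Data.Sum.Base using (_⊎_; inj₁; inj₂)
open import Data.Vec.Functional using (Vector)
open import Function.Bundles using (Inverse)
open import Level using (Level; 0ℓ; Lift; lift; lower) renaming (suc to lsuc)
open import Relation.Binary.Bundles using (Setoid; DecSetoid)
open import Relation.Binary.Core using (Rel)
open import Relation.Binary.PropositionalEquality as ≡ using (_≡_)
open import Relation.Binary.Properties.Setoid using (respʳ-flip)
open import Relation.Binary.Structures using (IsTotalOrder)
open import Relation.Nullary using (¬_; Dec; yes; no; does)
open import Relation.Nullary.Decidable using (map′)
open import Relation.Unary using (Pred; _∈_; _⊆_; _≐_; _∩_; U; Satisfiable)

private
  variable
    ℓ ℓ′ : Level

IsPrimePower : ℕ → Set
IsPrimePower q = ∃[ p ] ∃[ k ] (Prime p × q ≡ p ^ℕ suc k)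

IsMinimum : Pred ℕ ℓ → ℕ → Set ℓ
IsMinimum Q m = Q m × (∀ n → Q n → m ≤ℕ n)

-- The mathematics is classical: excluded middle decides the 0/1 matrix
-- entries and makes "no submodule other than 0 and W" meaningful.
em₀ : ExcludedMiddle (lsuc 0ℓ) → ExcludedMiddle 0ℓ
em₀ em {P} = map′ lower lift (em {Lift (lsuc 0ℓ) P})

lookup-injective : (S : Setoid ℓ ℓ′) (xs : List (Setoid.Carrier S)) → UniqueSetoid.Unique S xs →
                   ∀ i j → Setoid._≈_ S (lookup xs i) (lookup xs j) → i ≡ j
lookup-injective S (_ List.∷ _)  (_  ∷ _)  zero    zero    _ = ≡.refl
lookup-injective S (_ List.∷ _)  (px ∷ _)  zero    (suc j) e = ⊥-elim (All.lookup px (∈-lookup j) e)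
lookup-injective S (_ List.∷ _)  (px ∷ _)  (suc i) zero    e = ⊥-elim (All.lookup px (∈-lookup i) (Setoid.sym S e))
lookup-injective S (_ List.∷ xs) (_  ∷ us) (suc i) (suc j) e = ≡.cong suc (lookup-injective S xs us i j e)

-- The value of 0# ⁻¹ is unspecified.
record Field : Set₁ where
  infix 8 _⁻¹
  field
    commutativeRing : CommutativeRing 0ℓ 0ℓ
  open CommutativeRing commutativeRing public hiding (zero)
  field
    _⁻¹      : Carrier → Carrier
    ⁻¹-cong  : ∀ {x y} → x ≈ y → x ⁻¹ ≈ y ⁻¹
    *-invʳ   : ∀ {x} → x ≉ 0# → x * x ⁻¹ ≈ 1#
    1≉0      : 1# ≉ 0#

HasCardinality : Setoid 0ℓ 0ℓ → ℕ → Set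
HasCardinality S n = Inverse (≡.setoid (Fin n)) S

-- The categorical axioms of the real numbers: under excluded middle they
-- determine ℝ up to a unique isomorphism.
record CompleteOrderedField : Set₁ where
  infix 4 _≤_
  field
    field′ : Field
  open Field field′ public
  field
    _≤_          : Rel Carrier 0ℓ
    isTotalOrder : IsTotalOrder _≈_ _≤_
    +-monoʳ-≤    : ∀ z {x y} → x ≤ y → z + x ≤ z + y
    *-nonneg     : ∀ {x y} → 0# ≤ x → 0# ≤ y → 0# ≤ x * y

  IsUpperBound : Pred Carrier 0ℓ → Pred Carrier 0ℓ
  IsUpperBound S b = ∀ x → x ∈ S → x ≤ b

  IsSupremum : Pred Carrier 0ℓ → Pred Carrier 0ℓ
  IsSupremum S s = IsUpperBound S s × (∀ b → IsUpperBound S b → s ≤ b)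

  field
    supremum : (S : Pred Carrier 0ℓ) → Satisfiable S → Satisfiable (IsUpperBound S) →
               Satisfiable (IsSupremum S)

  open IsTotalOrder isTotalOrder public
    using (total; ≤-respʳ-≈; ≤-respˡ-≈)
    renaming (trans to ≤-trans; reflexive to ≤-reflexive)

  fromℕ : ℕ → Carrier
  fromℕ zero    = 0#
  fromℕ (suc n) = 1# + fromℕ n

  infixr 8 _^_ _^ℤ_
  _^_ : Carrier → ℕ → Carrier
  x ^ zero  = 1#
  x ^ suc n = x * x ^ n

  _^ℤ_ : Carrier → ℤ → Carrier
  x ^ℤ (+ n)      = x ^ n
  x ^ℤ (-[1+ n ]) = (x ⁻¹) ^ suc n

  module _ where
    private
      open import Algebra.Properties.Ring ring using (-‿distribˡ-*; -‿involutive; -‿distribʳ-*)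
      open import Relation.Binary.Reasoning.Setoid setoid

      0≤-x : ∀ {x} → x ≤ 0# → 0# ≤ - x
      0≤-x {x} x≤0 = ≤-respˡ-≈ (-‿inverseˡ x) (≤-respʳ-≈ (+-identityʳ (- x)) (+-monoʳ-≤ (- x) x≤0))

      -x*-y : ∀ x y → - x * - y ≈ x * y
      -x*-y x y = begin
        - x * - y      ≈⟨ sym (-‿distribˡ-* x (- y)) ⟩
        - (x * - y)    ≈⟨ -‿cong (sym (-‿distribʳ-* x y)) ⟩
        - - (x * y)    ≈⟨ -‿involutive (x * y) ⟩
        x * y          ∎

    0≤1 : 0# ≤ 1#
    0≤1 with total 0# 1#
    ... | inj₁ p = p
    ... | inj₂ p = ≤-respʳ-≈ (trans (-x*-y 1# 1#) (*-identityˡ 1#)) (*-nonneg (0≤-x p) (0≤-x p))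

    fromℕ-nonneg : ∀ n → 0# ≤ fromℕ n
    fromℕ-nonneg zero    = ≤-reflexive refl
    fromℕ-nonneg (suc n) =
      ≤-trans 0≤1 (≤-respˡ-≈ (+-identityʳ 1#) (+-monoʳ-≤ 1# (fromℕ-nonneg n)))

    private
      1≤y⇒y≤y² : ∀ {y} → 1# ≤ y → y ≤ y * y
      1≤y⇒y≤y² {y} 1≤y = ≤-respˡ-≈ (+-identityʳ y) (≤-respʳ-≈ eq (+-monoʳ-≤ y nonneg))
        where
        0≤y-1 : 0# ≤ - 1# + y
        0≤y-1 = ≤-respˡ-≈ (-‿inverseˡ 1#) (+-monoʳ-≤ (- 1#) 1≤y)
        nonneg : 0# ≤ y * (- 1# + y)
        nonneg = *-nonneg (≤-trans 0≤1 1≤y) 0≤y-1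
        eq : y + y * (- 1# + y) ≈ y * y
        eq = begin
          y + y * (- 1# + y)        ≈⟨ +-congʳ (sym (*-identityʳ y)) ⟩
          y * 1# + y * (- 1# + y)   ≈⟨ sym (distribˡ y 1# (- 1# + y)) ⟩
          y * (1# + (- 1# + y))     ≈⟨ *-congˡ (sym (+-assoc 1# (- 1#) y)) ⟩
          y * ((1# + - 1#) + y)     ≈⟨ *-congˡ (+-congʳ (-‿inverseʳ 1#)) ⟩
          y * (0# + y)              ≈⟨ *-congˡ (+-identityˡ y) ⟩
          y * y                     ∎

      bound : ∀ n y → y * y ≤ fromℕ n → y ≤ fromℕ (suc n)
      bound n y y²≤n with total y 1#
      ... | inj₁ y≤1 = ≤-trans y≤1 (≤-respˡ-≈ (+-identityʳ 1#) (+-monoʳ-≤ 1# (fromℕ-nonneg n)))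
      ... | inj₂ 1≤y = ≤-trans (1≤y⇒y≤y² 1≤y) (≤-trans y²≤n
              (≤-respˡ-≈ (+-identityˡ (fromℕ n))
                (≤-respˡ-≈ (+-comm (fromℕ n) 0#)
                  (≤-respʳ-≈ (+-comm (fromℕ n) 1#) (+-monoʳ-≤ (fromℕ n) 0≤1)))))

    √-supremum : ∀ n → Satisfiable (IsSupremum (λ y → y * y ≤ fromℕ n))
    √-supremum n = supremum _
      (0# , ≤-respˡ-≈ (sym (zeroˡ 0#)) (fromℕ-nonneg n)) (fromℕ (suc n) , bound n)

  √ : ℕ → Carrier
  √ n = proj₁ (√-supremum n)

module LinearAlgebra {K : Set} (_≈_ : Rel K 0ℓ) (0# : K) (M : RawLeftModule K 0ℓ 0ℓ) where
  open RawLeftModule M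

  ∑ : ∀ {n} → Vector Carrierᴹ n → Carrierᴹ
  ∑ = RawMonoidSum.sum +ᴹ-rawMonoid

  combination : ∀ {n} → Vector K n → Vector Carrierᴹ n → Carrierᴹ
  combination c b = ∑ λ k → c k *ₗ b k

  LinearlyIndependent : ∀ {n} → Vector Carrierᴹ n → Set
  LinearlyIndependent b = ∀ c → combination c b ≈ᴹ 0ᴹ → ∀ k → c k ≈ 0#

  HasDimension : Pred Carrierᴹ ℓ → ℕ → Set ℓ
  HasDimension W d = ∃[ b ]
    ((∀ (k : Fin d) → b k ∈ W) × LinearlyIndependent b × (∀ v → v ∈ W → ∃[ c ] v ≈ᴹ combination c b))

  record IsSubspace (W : Pred Carrierᴹ ℓ) : Set ℓ where
    field
      resp     : ∀ {v w} → v ≈ᴹ w → v ∈ W → w ∈ W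
      0-mem    : 0ᴹ ∈ W
      +-closed : ∀ {v w} → v ∈ W → w ∈ W → v +ᴹ w ∈ W
      *-closed : ∀ a {v} → v ∈ W → a *ₗ v ∈ W

  data Span (S : Pred Carrierᴹ ℓ) : Pred Carrierᴹ ℓ where
    incl  : ∀ {v} → v ∈ S → v ∈ Span S
    resp  : ∀ {v w} → v ≈ᴹ w → v ∈ Span S → w ∈ Span S
    0-mem : 0ᴹ ∈ Span S
    add   : ∀ {v w} → v ∈ Span S → w ∈ Span S → v +ᴹ w ∈ Span S
    scale : ∀ a {v} → v ∈ Span S → a *ₗ v ∈ Span S

  span-isSubspace : (S : Pred Carrierᴹ ℓ) → IsSubspace (Span S)
  span-isSubspace S = record { resp = resp ; 0-mem = 0-mem ; +-closed = add ; *-closed = scale }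

  SumOf : ∀ {n} → (Fin n → Pred Carrierᴹ ℓ) → Pred Carrierᴹ ℓ
  SumOf W v = ∃[ w ] ((∀ k → w k ∈ W k) × v ≈ᴹ ∑ w)

  IsZero : Pred Carrierᴹ ℓ → Set ℓ
  IsZero W = ∀ v → v ∈ W → v ≈ᴹ 0ᴹ

  Nonzero : Pred Carrierᴹ ℓ → Set ℓ
  Nonzero W = ∃[ v ] (v ∈ W × ¬ v ≈ᴹ 0ᴹ)

module Complex (ℝ : CompleteOrderedField) where
  private
    module ℝ = CompleteOrderedField ℝ

  ℂ : Set
  ℂ = ℝ.Carrier × ℝ.Carrier

  infix  4 _≈_
  infixl 6 _+_ _-_
  infixl 7 _*_

  _≈_ : Rel ℂ 0ℓ
  (a , b) ≈ (c , d) = (a ℝ.≈ c) × (b ℝ.≈ d)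

  _+_ _-_ _*_ : ℂ → ℂ → ℂ
  (a , b) + (c , d) = (a ℝ.+ c , b ℝ.+ d)
  (a , b) - (c , d) = (a ℝ.- c , b ℝ.- d)
  (a , b) * (c , d) = (a ℝ.* c ℝ.- b ℝ.* d , a ℝ.* d ℝ.+ b ℝ.* c)

  conj : ℂ → ℂ
  conj (a , b) = (a , ℝ.- b)

  real : ℝ.Carrier → ℂ
  real a = (a , ℝ.0#)

  0ℂ 1ℂ : ℂ
  0ℂ = real ℝ.0#
  1ℂ = real ℝ.1#

  ℂ^_ : ℕ → RawLeftModule ℂ 0ℓ 0ℓ
  ℂ^ n = record
    { Carrierᴹ = Vector ℂ n
    ; _≈ᴹ_     = λ u v → ∀ k → u k ≈ v k
    ; _+ᴹ_     = λ u v k → u k + v k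
    ; _*ₗ_     = λ a v k → a * v k
    ; 0ᴹ       = λ _ → 0ℂ
    ; -ᴹ_      = λ v k → 0ℂ - v k
    }

  module ℂVec {n : ℕ} = LinearAlgebra _≈_ 0ℂ (ℂ^ n)
  open ℂVec public

  _≈ᵛ_ : ∀ {n} → Rel (Vector ℂ n) 0ℓ
  _≈ᵛ_ {n} = RawLeftModule._≈ᴹ_ (ℂ^ n)

  sumℂ : ∀ {n} → Vector ℂ n → ℂ
  sumℂ = RawMonoidSum.sum (record { Carrier = ℂ ; _≈_ = _≈_ ; _∙_ = _+_ ; ε = 0ℂ })

  Mat : ℕ → Set
  Mat n = Fin n → Fin n → ℂ

  infixr 7 _∙_ _⊡_
  _∙_ : ∀ {n} → Mat n → Vector ℂ n → Vector ℂ n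
  (M ∙ v) i = sumℂ λ j → M i j * v j

  _⊡_ : ∀ {n} → Mat n → Mat n → Mat n
  (M ⊡ M′) i k = sumℂ λ j → M i j * M′ j k

  transpose : ∀ {n} → Mat n → Mat n
  transpose M i j = M j i

  diag : ∀ {n} → Vector ℂ n → Mat n
  diag d i j = if does (i Fin.≟ j) then d i else 0ℂ

  -- The unital subalgebra generated by a set of matrices.
  data Generated {n} (G : Pred (Mat n) 0ℓ) : Pred (Mat n) 0ℓ where
    gen   : ∀ {M} → M ∈ G → M ∈ Generated G
    resp  : ∀ {M M′} → (∀ i j → M i j ≈ M′ i j) → M ∈ Generated G → M′ ∈ Generated G
    one   : diag (λ _ → 1ℂ) ∈ Generated G
    add   : ∀ {M M′} → M ∈ Generated G → M′ ∈ Generated G → (λ i j → M i j + M′ i j) ∈ Generated G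
    scale : ∀ a {M} → M ∈ Generated G → (λ i j → a * M i j) ∈ Generated G
    mul   : ∀ {M M′} → M ∈ Generated G → M′ ∈ Generated G → M ⊡ M′ ∈ Generated G

  record IsModule {n} (𝒜 : Pred (Mat n) 0ℓ) (W : Pred (Vector ℂ n) ℓ) : Set ℓ where
    field
      isSubspace : IsSubspace W
      invariant  : ∀ {M v} → M ∈ 𝒜 → v ∈ W → M ∙ v ∈ W

  record IsIrreducible {n} (𝒜 : Pred (Mat n) 0ℓ) (W : Pred (Vector ℂ n) 0ℓ) : Set₁ where
    field
      isModule : IsModule 𝒜 W
      nonzero  : Nonzero W
      simple   : (W′ : Pred (Vector ℂ n) 0ℓ) → IsModule 𝒜 W′ → W′ ⊆ W → IsZero W′ ⊎ W′ ≐ W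

  Image : ∀ {n} → Mat n → Pred (Vector ℂ n) ℓ → Pred (Vector ℂ n) ℓ
  Image M W v = ∃[ w ] (w ∈ W × v ≈ᵛ (M ∙ w))

  ⟨_,_⟩ : ∀ {n} → Vector ℂ n → Vector ℂ n → ℂ
  ⟨ u , v ⟩ = sumℂ λ k → u k * conj (v k)

  Eigenspace : ∀ {n} → Mat n → ℂ → Pred (Vector ℂ n) 0ℓ
  Eigenspace M θ v = (M ∙ v) ≈ᵛ (λ k → θ * v k)

  IsOrthogonalProjection : ∀ {n} → Pred (Vector ℂ n) 0ℓ → Vector ℂ n → Vector ℂ n → Set
  IsOrthogonalProjection W v p = p ∈ W × (∀ w → w ∈ W → ⟨ (λ k → v k - p k) , w ⟩ ≈ 0ℂ)

  ProjectionImage : ∀ {n} → Pred (Vector ℂ n) 0ℓ → Pred (Vector ℂ n) 0ℓ → Pred (Vector ℂ n) 0ℓ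
  ProjectionImage E W p = ∃[ w ] (w ∈ W × IsOrthogonalProjection E w p)

FieldModule : Field → Set₁
FieldModule F = LeftModule (Field.ring F) 0ℓ 0ℓ

module VectorSpace (F : Field) (𝒱 : FieldModule F) =
  LinearAlgebra (Field._≈_ F) (Field.0# F) (LeftModule.rawLeftModule 𝒱)

HasDimension𝒱 : (F : Field) → FieldModule F → ℕ → Set
HasDimension𝒱 F 𝒱 N = VectorSpace.HasDimension F 𝒱 U N

module FiniteVectorSpace
  (em : ExcludedMiddle (lsuc 0ℓ))
  (F : Field) {q : ℕ} (card : HasCardinality (Field.setoid F) q)
  (𝒱 : FieldModule F) {N : ℕ} (dim𝒱 : HasDimension𝒱 F 𝒱 N)
  where

  open VectorSpace F 𝒱 public
  open LeftModule 𝒱 using (Carrierᴹ; _≈ᴹ_; _*ₗ_; ≈ᴹ-sym; ≈ᴹ-trans; *ₗ-cong; ≈ᴹ-refl; +ᴹ-monoid)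
  private
    module F = Field F
    module card = Inverse card

  Subspace : Set₁
  Subspace = Σ (Pred Carrierᴹ 0ℓ) IsSubspace

  subspaceDecSetoid : DecSetoid (lsuc 0ℓ) 0ℓ
  subspaceDecSetoid = record
    { Carrier = Subspace
    ; _≈_ = λ S S′ → proj₁ S ≐ proj₁ S′
    ; isDecEquivalence = record
      { isEquivalence = record
        { refl  = (λ z → z) , (λ z → z)
        ; sym   = λ (f , g) → g , f
        ; trans = λ (f , g) (h , k) → (λ z → h (f z)) , (λ z → g (k z))
        }
      ; _≟_ = λ _ _ → em₀ em
      }
    }

  open DecSetoid subspaceDecSetoid using (setoid; _≟_)

  vector : Fin (q ^ℕ N) → Carrierᴹ
  vector k = combination (λ i → card.to (finToFun k i)) (proj₁ dim𝒱)

  selected : Fin (2 ^ℕ (q ^ℕ N)) → Pred Carrierᴹ 0ℓ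
  selected s v = ∃[ k ] (v ≡ vector k × finToFun s k ≡ suc zero)

  spanned : Fin (2 ^ℕ (q ^ℕ N)) → Subspace
  spanned s = Span (selected s) , span-isSubspace (selected s)

  -- Spans of all subsets of 𝒱, with repetitions removed: each subspace of 𝒱
  -- occurs exactly once (subspace-complete, subspace-injective).
  subspaces : List Subspace
  subspaces = deduplicate _≟_ (tabulate spanned)

  ∣P∣ : ℕ
  ∣P∣ = length subspaces

  P : Set
  P = Fin ∣P∣

  ⟦_⟧ : P → Pred Carrierᴹ 0ℓ
  ⟦ u ⟧ = proj₁ (lookup subspaces u)

  private
    vector-surjective : ∀ v → ∃[ k ] v ≈ᴹ vector k
    vector-surjective v with proj₂ (proj₂ (proj₂ dim𝒱)) v _
    ... | c , v≈ = k , ≈ᴹ-trans v≈ (MonoidSum.sum-cong-≋ +ᴹ-monoid λ i →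
                     *ₗ-cong (F.sym (F.trans (F.reflexive (≡.cong card.to (Fin.finToFun-funToFin g i)))
                                             (card.inverseˡ ≡.refl))) ≈ᴹ-refl)
      where
      g = λ i → card.from (c i)
      k = funToFin g

    spanned-complete : (S : Subspace) → ∃[ s ] (proj₁ (spanned s) ≐ proj₁ S)
    spanned-complete (S , isS) = s , to , from
      where
      open IsSubspace isS renaming (resp to S-resp; 0-mem to S-0)
      bit : {A : Set} → Dec A → Fin 2
      bit (yes _) = suc zero
      bit (no _)  = zero
      bit⁻ : {A : Set} (a? : Dec A) → bit a? ≡ suc zero → A
      bit⁻ (yes a) _ = a
      bit⁺ : {A : Set} (a? : Dec A) → A → bit a? ≡ suc zero
      bit⁺ (yes _) _ = ≡.refl
      bit⁺ (no ¬a) a = ⊥-elim (¬a a)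
      g : Fin (q ^ℕ N) → Fin 2
      g k = bit (em₀ em {vector k ∈ S})
      s = funToFin g
      to : Span (selected s) ⊆ S
      to (incl (k , ≡.refl , e)) = bit⁻ (em₀ em) (≡.trans (≡.sym (Fin.finToFun-funToFin g k)) e)
      to (resp e m)  = S-resp e (to m)
      to 0-mem       = S-0
      to (add m m′)  = +-closed (to m) (to m′)
      to (scale a m) = *-closed a (to m)
      from : S ⊆ Span (selected s)
      from {v} m with vector-surjective v
      ... | k , e = resp (≈ᴹ-sym e)
        (incl (k , ≡.refl , ≡.trans (Fin.finToFun-funToFin g k) (bit⁺ (em₀ em) (S-resp e m))))

  subspace-complete : (S : Subspace) → ∃[ u ] (⟦ u ⟧ ≐ proj₁ S)
  subspace-complete S with spanned-complete S
  ... | s , s≐S@(f , g) = Any.index m , (λ z → proj₂ (Any.lookup-index m) z) , (λ z → proj₁ (Any.lookup-index m) z)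
    where
    m : Any.Any (λ T → proj₁ S ≐ proj₁ T) subspaces
    m = Membership.∈-deduplicate⁺ setoid _≟_
          (λ {S₁} {S₂} {S₃} → respʳ-flip setoid {S₁} {S₂} {S₃}) {xs = tabulate spanned} {z = S}
          (Any.tabulate⁺ s (g , f))

  subspace-injective : ∀ u v → ⟦ u ⟧ ≐ ⟦ v ⟧ → u ≡ v
  subspace-injective = lookup-injective setoid subspaces (Unique.deduplicate-! subspaceDecSetoid (tabulate spanned))

module Grassmann
  (em : ExcludedMiddle (lsuc 0ℓ)) (ℝ : CompleteOrderedField)
  (F : Field) {q : ℕ} (card : HasCardinality (Field.setoid F) q)
  (𝒱 : FieldModule F) {N : ℕ} (dim𝒱 : HasDimension𝒱 F 𝒱 N)
  (D : ℕ)
  where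

  module 𝒱-subspaces = FiniteVectorSpace em F card 𝒱 dim𝒱
  open 𝒱-subspaces public using (P; ∣P∣; ⟦_⟧)
  open 𝒱-subspaces using () renaming (HasDimension to HasDim)
  open Complex ℝ public
  private
    module ℝ = CompleteOrderedField ℝ

  grassmannVertices : List P
  grassmannVertices = filter (λ u → em₀ em {HasDim ⟦ u ⟧ D}) (allFin ∣P∣)

  ∣X∣ : ℕ
  ∣X∣ = length grassmannVertices

  X : Set
  X = Fin ∣X∣

  vertex : X → P
  vertex = lookup grassmannVertices

  vertex-HasDim : ∀ y → HasDim ⟦ vertex y ⟧ D
  vertex-HasDim y = proj₂ (∈-filter⁻ (λ _ → em₀ em) {xs = allFin ∣P∣} (∈-lookup y))

  vertex-complete : ∀ u → HasDim ⟦ u ⟧ D → ∃[ y ] u ≡ vertex y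
  vertex-complete u h = Any.index m , Any.lookup-index m
    where
    m : u ∈ˡ grassmannVertices
    m = ∈-filter⁺ (λ _ → em₀ em) (∈-allFin u) h

  vertex-injective : ∀ y z → vertex y ≡ vertex z → y ≡ z
  vertex-injective y z = lookup-injective (≡.setoid P) grassmannVertices
    (UniqueP.filter⁺ (λ _ → em₀ em) (UniqueP.allFin⁺ ∣P∣)) y z

  V Ψ : Set
  V = Vector ℂ ∣X∣
  Ψ = Vector ℂ ∣P∣

  Iverson : Set → ℂ
  Iverson A = if does (em₀ em {A}) then 1ℂ else 0ℂ

  Adjacent : X → X → Set
  Adjacent y z = HasDim (⟦ vertex y ⟧ ∩ ⟦ vertex z ⟧) (D ∸ 1)

  data Walk : X → X → ℕ → Set where
    []  : ∀ {y} → Walk y y 0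
    _∷_ : ∀ {y z w n} → Adjacent y z → Walk z w n → Walk y w (suc n)

  Distance : X → X → ℕ → Set
  Distance y z = IsMinimum (Walk y z)

  A : Mat ∣X∣
  A y z = Iverson (Adjacent y z)

  [_]q : ℕ → ℝ.Carrier
  [ l ]q = (ℝ.fromℕ q ℝ.^ l ℝ.- ℝ.1#) ℝ.* (ℝ.fromℕ q ℝ.- ℝ.1#) ℝ.⁻¹

  θ : ℕ → ℝ.Carrier
  θ i = ℝ.fromℕ q ℝ.* [ D ]q ℝ.* [ N ∸ D ]q ℝ.- [ i ]q ℝ.* [ (N ∸ i) +ℕ 1 ]q

  -- E-image i W is Eᵢ W, for Eᵢ the orthogonal projection onto the θᵢ-eigenspace.
  E-image : ℕ → Pred V 0ℓ → Pred V 0ℓ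
  E-image i = ProjectionImage (Eigenspace A (real (θ i)))

  -- Extension by zero, identifying V with the vectors of Ψ supported on X.
  embed : V → Ψ
  embed v u = sumℂ λ y → Iverson (vertex y ≡ u) * v y

  module At (x : X) where

    E* : ℕ → Mat ∣X∣
    E* i = diag λ y → Iverson (Distance x y i)

    data T-generator : Pred (Mat ∣X∣) 0ℓ where
      A-gen  : T-generator A
      E*-gen : ∀ {i} → i ≤ℕ D → T-generator (E* i)

    T : Pred (Mat ∣X∣) 0ℓ
    T = Generated T-generator

    IsIrreducibleT : Pred V 0ℓ → Set₁
    IsIrreducibleT = IsIrreducible T

    IsEndpoint : Pred V 0ℓ → ℕ → Set
    IsEndpoint W = IsMinimum λ i → i ≤ℕ D × Nonzero (Image (E* i) W)

    IsDualEndpoint : Pred V 0ℓ → ℕ → Set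
    IsDualEndpoint W = IsMinimum λ i → i ≤ℕ D × Nonzero (E-image i W)

    diameter : Pred V 0ℓ → ℤ
    diameter W = + length (filter (λ i → em₀ em {Nonzero (Image (E* i) W)}) (upTo (suc D))) -ℤ + 1

    HasDisplacement : Pred V 0ℓ → ℤ → Set
    HasDisplacement W δ = ∃₂ λ r t →
      IsEndpoint W r × IsDualEndpoint W t × δ ≡ (+ r +ℤ + t -ℤ + D) +ℤ diameter W

    Nucleus : Pred V (lsuc 0ℓ)
    Nucleus = Span λ v → Σ (Pred V 0ℓ) λ W → IsIrreducibleT W × HasDisplacement W (+ 0) × v ∈ W

    P[_,_] : ℕ → ℕ → Pred P 0ℓ
    P[ i , j ] u = HasDim (⟦ u ⟧ ∩ ⟦ vertex x ⟧) i × HasDim ⟦ u ⟧ (i +ℕ j)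

    Covers : P → P → Set
    Covers v u = ⟦ u ⟧ ⊆ ⟦ v ⟧ × (∃[ m ] (HasDim ⟦ u ⟧ m × HasDim ⟦ v ⟧ (suc m)))

    _/-covers_ _\-covers_ : P → P → Set
    v /-covers u = Covers v u × (∃₂ λ i j → u ∈ P[ i , j ] × v ∈ P[ suc i , j ])
    v \-covers u = Covers v u × (∃₂ λ i j → u ∈ P[ i , j ] × v ∈ P[ i , suc j ])

    E*[_,_] : ℕ → ℕ → Mat ∣P∣
    E*[ i , j ] = diag λ u → Iverson (u ∈ P[ i , j ])

    -- The diagonal matrix with (u,u)-entry q^(e i j / 2) for u ∈ P[ i , j ], where
    -- the half-integral power of q is an integral power of √ q; the
    -- sum has a single nonzero term because the sets P[ i , j ] partition P.
    q^½ : (ℕ → ℕ → ℤ) → Mat ∣P∣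
    q^½ e = diag λ u → sumℂ λ (i : Fin (suc D)) → sumℂ λ (j : Fin (suc (N ∸ D))) →
      Iverson (u ∈ P[ toℕ i , toℕ j ]) * real (ℝ.√ q ℝ.^ℤ e (toℕ i) (toℕ j))

    K₁ K₁⁻¹ K₂ K₂⁻¹ L₁ L₂ R₁ R₂ : Mat ∣P∣
    K₁   = q^½ λ i j → + D -ℤ + 2 *ℤ + i
    K₁⁻¹ = q^½ λ i j → -ℤ (+ D -ℤ + 2 *ℤ + i)
    K₂   = q^½ λ i j → (+ N -ℤ + D) -ℤ + 2 *ℤ + j
    K₂⁻¹ = q^½ λ i j → -ℤ ((+ N -ℤ + D) -ℤ + 2 *ℤ + j)
    L₁ u v = Iverson (v /-covers u)
    L₂ u v = Iverson (v \-covers u)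
    R₁ = transpose L₁
    R₂ = transpose L₂

    data ℋ-generator : Pred (Mat ∣P∣) 0ℓ where
      L₁-gen   : ℋ-generator L₁
      L₂-gen   : ℋ-generator L₂
      R₁-gen   : ℋ-generator R₁
      R₂-gen   : ℋ-generator R₂
      K₁-gen   : ℋ-generator K₁
      K₁⁻¹-gen : ℋ-generator K₁⁻¹
      K₂-gen   : ℋ-generator K₂
      K₂⁻¹-gen : ℋ-generator K₂⁻¹

    ℋ : Pred (Mat ∣P∣) 0ℓ
    ℋ = Generated ℋ-generator

    IsIrreducibleℋ : Pred Ψ 0ℓ → Set₁
    IsIrreducibleℋ = IsIrreducible ℋ

    record HasType (Ω : Pred Ψ 0ℓ) (α β ρ : ℕ) : Set where
      InSupport : ℕ → ℕ → Set
      InSupport i j = (α ≤ℕ i × i ≤ℕ D ∸ ρ ∸ α) × (ρ +ℕ β ≤ℕ j × j ≤ℕ N ∸ D ∸ β)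
      field
        α-bound : 2 *ℕ α +ℕ ρ ≤ℕ D
        β-bound : 2 *ℕ β +ℕ ρ ≤ℕ N ∸ D
        dim-one  : ∀ i j → i ≤ℕ D → j ≤ℕ N ∸ D → InSupport i j →
                   HasDimension (Image E*[ i , j ] Ω) 1
        dim-zero : ∀ i j → i ≤ℕ D → j ≤ℕ N ∸ D → ¬ InSupport i j →
                   HasDimension (Image E*[ i , j ] Ω) 0

    IsAlphaDominant : Pred Ψ 0ℓ → ℕ → Set
    IsAlphaDominant Ω gap = HasType Ω gap 0 0

    -- Ω̃, pulled back along the inclusion of V in Ψ.
    tilde : Pred Ψ 0ℓ → Pred V 0ℓ
    tilde Ω v = embed v ∈ SumOf {n = ∣P∣} {n = suc D} λ j → Image E*[ D ∸ toℕ j , toℕ j ] Ω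

    -- One universe up, being an intersection over predicates.
    _^ℋ : Pred V 0ℓ → Pred Ψ (lsuc 0ℓ)
    (W ^ℋ) ψ = (Ω : Pred Ψ 0ℓ) → IsModule ℋ Ω → tilde Ω ≐ W → ψ ∈ Ω

{-# OPTIONS --safe #-}
-- Every ℋ-module Ω is stable under the projections E*[ i , j ]: these are polynomials
-- in K₁ and K₂, whose eigenvalues are powers of √ q > 1.
-- Hence embed v ∈ Ω for v ∈ tilde Ω, and tilde Ω = W forces the irreducible Ω to meet, and
-- so to lie in, every ℋ-module Ω′ with tilde Ω′ = W.
-- Conversely, Ω = W ^ℋ gives tilde Ω = W as soon as some ℋ-module Ω₀ has tilde Ω₀ = W.
-- If none has, then W ^ℋ, an empty intersection, is all of Ψ; but Ψ has no type,
-- because P[ 0 , 1 ] contains two distinct lines.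
module Submission where

open import Defs
open import Algebra.Bundles using (CommutativeRing)
open import Algebra.Module.Bundles using (LeftModule)
import Algebra.Properties.AbelianGroup as AbelianGroupProperties
import Algebra.Properties.CommutativeMonoid.Sum as CommutativeMonoidSum
import Algebra.Properties.Group as GroupProperties
import Algebra.Properties.Monoid.Sum as MonoidSum
import Algebra.Properties.Ring as RingProperties
import Algebra.Solver.Ring.NaturalCoefficients.Default as SemiringSolver
open import Algebra.Structures using (IsCommutativeRing)
open import Axiom.ExcludedMiddle using (ExcludedMiddle)
open import Data.Bool.Base using (if_then_else_)
open import Data.Empty using (⊥-elim)
open import Data.Fin.Base using (Fin; zero; suc; toℕ; fromℕ<; finToFun; funToFin; combine)
import Data.Fin.Properties as Fin
open import Data.Integer.Base as ℤ using (ℤ; +_; -[1+_])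
import Data.Integer.Properties as ℤ
open import Data.List.Base using (lookup)
open import Data.Nat.Base as ℕ using (ℕ; zero; suc; _≤_; _<_; s≤s; z≤n; _∸_)
open import Data.Nat.Primality using (prime⇒nonTrivial; prime⇒nonZero)
import Data.Nat.Properties as ℕ
open import Data.Product using (_×_; _,_; proj₁; proj₂; ∃-syntax; ∃₂)
open import Data.Sum.Base using (inj₁; inj₂; [_,_]′)
open import Data.Unit.Base using (tt)
open import Data.Vec.Functional using (Vector)
open import Function.Base using (_∘_)
open import Function.Bundles using (Inverse; _⇔_; mk⇔)
open import Function.Definitions using (Injective)
open import Level using (0ℓ) renaming (suc to lsuc)
import Relation.Binary.Reasoning.Setoid as SetoidReasoning
open import Relation.Binary.PropositionalEquality as ≡ using (_≡_; _≢_)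
open import Relation.Binary.Structures using (IsTotalOrder)
open import Relation.Nullary using (¬_; Dec; yes; no; does)
open import Relation.Nullary.Decidable using (dec-true; dec-false)
open import Relation.Unary using (Pred; _∈_; _∉_; _⊆_; _≐_; _∩_; U)

-- `W ^ℋ` lives one universe above the predicates over which `simple` quantifies, so it cannot
-- itself be offered as a submodule of `Ω`. Irreducibility is therefore applied to `Ω ∩ Ω′` for one
-- competitor `Ω′` at a time; a single nonzero `w` of `W` keeps every such intersection nonzero,
-- because the same vector `embed w` lies in both modules. The projections are obtained by Lagrange
-- interpolation on the diagonals. The entry of `K₁` at a point of `P[ i , j ]` determines `i` and
-- that of `K₂` determines `j`, because the integral powers of `√ q` are pairwise distinct; a point
-- outside the grid `i ≤ D`, `j ≤ N ∸ D` has entry 0, which is no power of `√ q`. The inequality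
-- `2 * D < N` puts every position `(D - j , j)` with `j ≤ D` inside that grid.

primePower≥2 : ∀ {q} → IsPrimePower q → 2 ≤ q
primePower≥2 (p , k , p-prime , ≡.refl) = ℕ.*-mono-≤
  (ℕ.nonTrivial⇒n>1 p {{prime⇒nonTrivial p-prime}}) (ℕ.m^n>0 p {{prime⇒nonZero p-prime}} k)

-- The exponents of `√ q` in `K₁` and `K₂` have this form, so distinct indices give distinct
-- exponents.
[c-2m]-injective : ∀ c {m n} → c ℤ.- + 2 ℤ.* + m ≡ c ℤ.- + 2 ℤ.* + n → m ≡ n
[c-2m]-injective c {m} {n} eq = ℤ.+-injective (ℤ.*-cancelˡ-≡ (+ 2) (+ m) (+ n)
  (ℤ.neg-injective (∙-cancelˡ c _ _ eq)))
  where open AbelianGroupProperties ℤ.+-0-abelianGroup using (∙-cancelˡ)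

module FieldProperties (F : Field) where
  open Field F
  open SetoidReasoning setoid

  x⁻¹*[x*y]≈y : ∀ {x} y → x ≉ 0# → x ⁻¹ * (x * y) ≈ y
  x⁻¹*[x*y]≈y {x} y x≉0 = begin
    x ⁻¹ * (x * y)  ≈⟨ *-assoc _ _ _ ⟨
    (x ⁻¹ * x) * y  ≈⟨ *-congʳ (trans (*-comm _ _) (*-invʳ x≉0)) ⟩
    1# * y          ≈⟨ *-identityˡ y ⟩
    y               ∎

  *-nonzero : ∀ {x y} → x ≉ 0# → y ≉ 0# → x * y ≉ 0#
  *-nonzero {x} {y} x≉0 y≉0 xy≈0 = y≉0 (begin
    y               ≈⟨ x⁻¹*[x*y]≈y y x≉0 ⟨
    x ⁻¹ * (x * y)  ≈⟨ *-congˡ xy≈0 ⟩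
    x ⁻¹ * 0#       ≈⟨ zeroʳ _ ⟩
    0#              ∎)

  ⁻¹-nonzero : ∀ {x} → x ≉ 0# → x ⁻¹ ≉ 0#
  ⁻¹-nonzero x≉0 x⁻¹≈0 = 1≉0 (trans (sym (*-invʳ x≉0)) (trans (*-congˡ x⁻¹≈0) (zeroʳ _)))

-- Integral powers and square roots in the real field.

module OrderedFieldProperties (ℝ : CompleteOrderedField) where
  open CompleteOrderedField ℝ renaming (_≤_ to _≤ℝ_)
  open FieldProperties field′
  open RingProperties ring using (-‿involutive; -‿distribˡ-*; -‿distribʳ-*)
  open SetoidReasoning setoid

  antisym : ∀ {x y} → x ≤ℝ y → y ≤ℝ x → x ≈ y
  antisym = IsTotalOrder.antisym isTotalOrder

  x≤x+y : ∀ x {y} → 0# ≤ℝ y → x ≤ℝ x + y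
  x≤x+y x 0≤y = ≤-respˡ-≈ (+-identityʳ x) (+-monoʳ-≤ x 0≤y)

  x≤y⇒0≤y-x : ∀ {x y} → x ≤ℝ y → 0# ≤ℝ - x + y
  x≤y⇒0≤y-x {x} x≤y = ≤-respˡ-≈ (-‿inverseˡ x) (+-monoʳ-≤ (- x) x≤y)

  x+[y-x]≈y : ∀ x y → x + (- x + y) ≈ y
  x+[y-x]≈y x y = trans (sym (+-assoc x (- x) y)) (trans (+-congʳ (-‿inverseʳ x)) (+-identityˡ y))

  *-monoʳ-≤ : ∀ {z x y} → 0# ≤ℝ z → x ≤ℝ y → z * x ≤ℝ z * y
  *-monoʳ-≤ {z} {x} {y} 0≤z x≤y = ≤-respʳ-≈
    (trans (sym (distribˡ z x (- x + y))) (*-congˡ (x+[y-x]≈y x y)))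
    (x≤x+y (z * x) (*-nonneg 0≤z (x≤y⇒0≤y-x x≤y)))

  0≤x*x : ∀ x → 0# ≤ℝ x * x
  0≤x*x x with total 0# x
  ... | inj₁ 0≤x = *-nonneg 0≤x 0≤x
  ... | inj₂ x≤0 = ≤-respʳ-≈ (begin
    - x * - x    ≈⟨ -‿distribˡ-* x (- x) ⟨
    - (x * - x)  ≈⟨ -‿cong (-‿distribʳ-* x x) ⟨
    - - (x * x)  ≈⟨ -‿involutive (x * x) ⟩
    x * x        ∎) (*-nonneg 0≤-x 0≤-x)
    where
    0≤-x : 0# ≤ℝ - x
    0≤-x = ≤-respʳ-≈ (+-identityʳ (- x)) (x≤y⇒0≤y-x x≤0)

  ⁻¹-nonneg : ∀ {x} → 0# ≤ℝ x → x ≉ 0# → 0# ≤ℝ x ⁻¹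
  ⁻¹-nonneg {x} 0≤x x≉0 = ≤-respʳ-≈ (begin
    x * (x ⁻¹ * x ⁻¹)   ≈⟨ *-assoc _ _ _ ⟨
    (x * x ⁻¹) * x ⁻¹   ≈⟨ *-congʳ (*-invʳ x≉0) ⟩
    1# * x ⁻¹           ≈⟨ *-identityˡ _ ⟩
    x ⁻¹                ∎) (*-nonneg 0≤x (0≤x*x (x ⁻¹)))

  1≤x⇒x≉0 : ∀ {x} → 1# ≤ℝ x → x ≉ 0#
  1≤x⇒x≉0 1≤x x≈0 = 1≉0 (antisym (≤-respʳ-≈ x≈0 1≤x) 0≤1)

  1≤^ : ∀ {x} → 1# ≤ℝ x → ∀ n → 1# ≤ℝ x ^ n
  1≤^ 1≤x zero    = ≤-reflexive refl
  1≤^ {x} 1≤x (suc n) = ≤-trans 1≤x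
    (≤-respˡ-≈ (*-identityʳ x) (*-monoʳ-≤ (≤-trans 0≤1 1≤x) (1≤^ 1≤x n)))

  -- Since `x ^ n` is at least 1, `x ≤ x * x ^ n`; were the product 1, `x` would be squeezed between
  -- 1 and 1.
  1<^ : ∀ {x} → 1# ≤ℝ x → x ≉ 1# → ∀ n → x ^ suc n ≉ 1#
  1<^ {x} 1≤x x≉1 n xⁿ≈1 = x≉1 (antisym
    (≤-respˡ-≈ (*-identityʳ x) (≤-respʳ-≈ xⁿ≈1 (*-monoʳ-≤ (≤-trans 0≤1 1≤x) (1≤^ 1≤x n)))) 1≤x)

  ^-nonzero : ∀ {x} → x ≉ 0# → ∀ n → x ^ n ≉ 0#
  ^-nonzero x≉0 zero    = 1≉0
  ^-nonzero x≉0 (suc n) = *-nonzero x≉0 (^-nonzero x≉0 n)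

  ^ℤ-nonzero : ∀ {x} → x ≉ 0# → ∀ e → x ^ℤ e ≉ 0#
  ^ℤ-nonzero x≉0 (+ n)    = ^-nonzero x≉0 n
  ^ℤ-nonzero x≉0 -[1+ n ] = ^-nonzero (⁻¹-nonzero x≉0) (suc n)

  ^ℤ-suc : ∀ {x} → x ≉ 0# → ∀ e → x ^ℤ (+ 1 ℤ.+ e) ≈ x * x ^ℤ e
  ^ℤ-suc x≉0 (+ n)    = refl
  ^ℤ-suc {x} x≉0 -[1+ n ] = trans (lower n) (trans (sym (*-identityˡ _))
    (trans (*-congʳ (sym (*-invʳ x≉0))) (*-assoc _ _ _)))
    -- The sum `+ 1 ℤ.+ -[1+ n ]` computes only once `n` is known to be zero or a successor.
    where
    lower : ∀ n → x ^ℤ (+ 1 ℤ.+ -[1+ n ]) ≈ (x ⁻¹) ^ n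
    lower zero    = refl
    lower (suc n) = refl

  ^ℤ-+ : ∀ {x} → x ≉ 0# → ∀ k e → x ^ℤ (+ k ℤ.+ e) ≈ x ^ k * x ^ℤ e
  ^ℤ-+ {x} x≉0 zero e = trans (reflexive (≡.cong (x ^ℤ_) (ℤ.+-identityˡ e))) (sym (*-identityˡ _))
  ^ℤ-+ {x} x≉0 (suc k) e = begin
    x ^ℤ (+ suc k ℤ.+ e)          ≡⟨ ≡.cong (x ^ℤ_) (ℤ.+-assoc (+ 1) (+ k) e) ⟩
    x ^ℤ (+ 1 ℤ.+ (+ k ℤ.+ e))    ≈⟨ ^ℤ-suc x≉0 (+ k ℤ.+ e) ⟩
    x * x ^ℤ (+ k ℤ.+ e)          ≈⟨ *-congˡ (^ℤ-+ x≉0 k e) ⟩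
    x * (x ^ k * x ^ℤ e)          ≈⟨ *-assoc _ _ _ ⟨
    x ^ suc k * x ^ℤ e            ∎

  module _ {x : Carrier} (1≤x : 1# ≤ℝ x) (x≉1 : x ≉ 1#) where
    private
      x≉0 : x ≉ 0#
      x≉0 = 1≤x⇒x≉0 1≤x

      -- Cancelling the nonzero factor `x ^ℤ e` leaves `x ^ k ≈ 1#`, which `1<^` excludes for
      -- positive `k`.
      shift-injective : ∀ k e → x ^ℤ (+ k ℤ.+ e) ≈ x ^ℤ e → + k ℤ.+ e ≡ e
      shift-injective zero    e _  = ℤ.+-identityˡ e
      shift-injective (suc k) e eq = ⊥-elim (1<^ 1≤x x≉1 k (begin
        p              ≈⟨ *-identityʳ p ⟨
        p * 1#         ≈⟨ *-congˡ (*-invʳ y≉0) ⟨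
        p * (y * y ⁻¹) ≈⟨ *-assoc p y _ ⟨
        (p * y) * y ⁻¹ ≈⟨ *-congʳ (trans (sym (^ℤ-+ x≉0 (suc k) e)) eq) ⟩
        y * y ⁻¹       ≈⟨ *-invʳ y≉0 ⟩
        1#             ∎))
        where
        p = x ^ suc k
        y = x ^ℤ e
        y≉0 = ^ℤ-nonzero x≉0 e

      ≤-case : ∀ {e f} → e ℤ.≤ f → x ^ℤ f ≈ x ^ℤ e → f ≡ e
      ≤-case {e} {f} e≤f eq = ≡.trans (≡.sym f≡)
        (shift-injective _ e (trans (reflexive (≡.cong (x ^ℤ_) f≡)) eq))
        where
        f≡ : + ℤ.∣ f ℤ.- e ∣ ℤ.+ e ≡ f
        f≡ = ≡.trans (≡.cong (λ g → g ℤ.+ e) (ℤ.0≤i⇒+∣i∣≡i (ℤ.i≤j⇒0≤j-i e≤f)))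
          (≡.trans (ℤ.+-assoc f (ℤ.- e) e)
          (≡.trans (≡.cong (λ g → f ℤ.+ g) (ℤ.+-inverseˡ e)) (ℤ.+-identityʳ f)))

    ^ℤ-injective : ∀ {e f} → x ^ℤ e ≈ x ^ℤ f → e ≡ f
    ^ℤ-injective {e} {f} eq with ℤ.≤-total e f
    ... | inj₁ e≤f = ≡.sym (≤-case e≤f (sym eq))
    ... | inj₂ f≤e = ≤-case f≤e eq

  √-upper : ∀ n {y} → y * y ≤ℝ fromℕ n → y ≤ℝ √ n
  √-upper n = proj₁ (proj₂ (√-supremum n)) _

  private
    1≤1+ : ∀ n → 1# ≤ℝ fromℕ (suc n)
    1≤1+ n = x≤x+y 1# (fromℕ-nonneg n)

  -- The number 1 belongs to the set whose supremum is `√ n`.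
  1≤√ : ∀ {n} → 1 ≤ n → 1# ≤ℝ √ n
  1≤√ {suc n} _ = √-upper (suc n) (≤-respˡ-≈ (sym (*-identityˡ 1#)) (1≤1+ n))

  -- The witness is 4/3, whose square is at most 2.
  √≉1 : ∀ {n} → 2 ≤ n → √ n ≉ 1#
  √≉1 {suc zero}    (s≤s ())
  √≉1 {suc (suc n)} _ √n≈1 = ⁻¹-nonzero 3≉0 (antisym a≤0 0≤a)
    where
    3# a : Carrier
    3# = 1# + (1# + 1#)
    a = 3# ⁻¹

    0≤2 : 0# ≤ℝ 1# + 1#
    0≤2 = ≤-trans 0≤1 (x≤x+y 1# 0≤1)

    3≉0 : 3# ≉ 0#
    3≉0 = 1≤x⇒x≉0 (x≤x+y 1# 0≤2)

    0≤a : 0# ≤ℝ a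
    0≤a = ⁻¹-nonneg (≤-trans 0≤2 (≤-respʳ-≈ (+-comm _ _) (x≤x+y _ 0≤1))) 3≉0

    open SemiringSolver commutativeSemiring using (solve; _:=_; _:+_; _:*_)

    3a≈1 : a + (a + a) ≈ 1#
    3a≈1 = begin
      a + (a + a)                      ≈⟨ +-cong (*-identityˡ a) (+-cong (*-identityˡ a) (*-identityˡ a)) ⟨
      1# * a + (1# * a + 1# * a)       ≈⟨ solve 2 (λ e a → e :* a :+ (e :* a :+ e :* a) := (e :+ (e :+ e)) :* a) refl 1# a ⟩
      3# * a                           ≈⟨ *-invʳ 3≉0 ⟩
      1#                               ∎

    -- With `a` equal to 1/3, `a` is three times its own square.
    a*a≤a : a * a ≤ℝ a
    a*a≤a = ≤-respʳ-≈ (begin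
      a * a + a * (a + a)  ≈⟨ distribˡ a a (a + a) ⟨
      a * (a + (a + a))    ≈⟨ *-congˡ 3a≈1 ⟩
      a * 1#               ≈⟨ *-identityʳ a ⟩
      a                    ∎)
      (x≤x+y (a * a) (*-nonneg 0≤a (≤-respˡ-≈ (+-identityʳ 0#)
        (≤-trans (+-monoʳ-≤ 0# 0≤a) (≤-trans (≤-reflexive (+-comm 0# a)) (+-monoʳ-≤ a 0≤a))))))

    -- The square is 1 + 2a + a², and replacing a² by the larger `a` gives 1 + 3a = 2.
    square≤2 : (1# + a) * (1# + a) ≤ℝ 1# + 1#
    square≤2 = ≤-respˡ-≈ expand (≤-respʳ-≈ (+-congˡ (trans (+-comm _ _) 3a≈1)) (+-monoʳ-≤ 1# (+-monoʳ-≤ (a + a) a*a≤a)))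
      where
      expand : 1# + ((a + a) + a * a) ≈ (1# + a) * (1# + a)
      expand = trans (+-congʳ (sym (*-identityˡ 1#)))
        (trans (+-congˡ (+-congʳ (+-cong (sym (*-identityˡ a)) (sym (*-identityˡ a)))))
          (solve 2 (λ e a → e :* e :+ ((e :* a :+ e :* a) :+ a :* a) := (e :+ a) :* (e :+ a)) refl 1# a))

    1+a≤1 : 1# + a ≤ℝ 1#
    1+a≤1 = ≤-respʳ-≈ √n≈1 (√-upper (suc (suc n)) (≤-trans square≤2 (+-monoʳ-≤ 1# (1≤1+ n))))

    a≤0 : a ≤ℝ 0#
    a≤0 = ≤-respʳ-≈ (-‿inverseˡ 1#)
      (≤-respˡ-≈ (trans (sym (+-assoc _ _ _)) (trans (+-congʳ (-‿inverseˡ 1#)) (+-identityˡ a)))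
        (+-monoʳ-≤ (- 1#) 1+a≤1))

-- The complex numbers as a commutative ring.

module ComplexRing (ℝ : CompleteOrderedField) where
  private
    module ℝ = CompleteOrderedField ℝ
  open Complex ℝ

  -- Subtraction is written as x + n * y with n = - 1# to obtain identities over a semiring.
  private
    open ℝ using (setoid; -_; 1#; commutativeSemiring; +-cong; +-congˡ; *-cong; *-congˡ)
      renaming (_≈_ to _≈ℝ_; _+_ to _+ℝ_; _*_ to _*ℝ_; _-_ to _-ℝ_)
    open RingProperties ℝ.ring using (-1*x≈-x)
    open SemiringSolver commutativeSemiring using (solve; _:=_; _:+_; _:*_)
    open SetoidReasoning setoid

    n : ℝ.Carrier
    n = - 1#

    x-y≈x+n*y : ∀ {x x′ y y′} → x ≈ℝ x′ → y ≈ℝ y′ → (x -ℝ y) ≈ℝ (x′ +ℝ n *ℝ y′)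
    x-y≈x+n*y {y = y} p e = +-cong p (ℝ.trans (ℝ.sym (-1*x≈-x y)) (*-congˡ e))

    assoc-re : ∀ a b c d e f →
      ((a *ℝ c -ℝ b *ℝ d) *ℝ e -ℝ (a *ℝ d +ℝ b *ℝ c) *ℝ f) ≈ℝ
      (a *ℝ (c *ℝ e -ℝ d *ℝ f) -ℝ b *ℝ (c *ℝ f +ℝ d *ℝ e))
    assoc-re a b c d e f = begin
      _ ≈⟨ x-y≈x+n*y (*-cong (x-y≈x+n*y ℝ.refl ℝ.refl) ℝ.refl) ℝ.refl ⟩
      (a *ℝ c +ℝ n *ℝ (b *ℝ d)) *ℝ e +ℝ n *ℝ ((a *ℝ d +ℝ b *ℝ c) *ℝ f)
        ≈⟨ solve 7 (λ n a b c d e f →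
             (a :* c :+ n :* (b :* d)) :* e :+ n :* ((a :* d :+ b :* c) :* f) :=
             a :* (c :* e :+ n :* (d :* f)) :+ n :* (b :* (c :* f :+ d :* e))) ℝ.refl n a b c d e f ⟩
      a *ℝ (c *ℝ e +ℝ n *ℝ (d *ℝ f)) +ℝ n *ℝ (b *ℝ (c *ℝ f +ℝ d *ℝ e))
        ≈⟨ ℝ.sym (x-y≈x+n*y (*-congˡ (x-y≈x+n*y ℝ.refl ℝ.refl)) ℝ.refl) ⟩
      _ ∎

    assoc-im : ∀ a b c d e f →
      ((a *ℝ c -ℝ b *ℝ d) *ℝ f +ℝ (a *ℝ d +ℝ b *ℝ c) *ℝ e) ≈ℝ
      (a *ℝ (c *ℝ f +ℝ d *ℝ e) +ℝ b *ℝ (c *ℝ e -ℝ d *ℝ f))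
    assoc-im a b c d e f = begin
      _ ≈⟨ +-cong (*-cong (x-y≈x+n*y ℝ.refl ℝ.refl) ℝ.refl) ℝ.refl ⟩
      (a *ℝ c +ℝ n *ℝ (b *ℝ d)) *ℝ f +ℝ (a *ℝ d +ℝ b *ℝ c) *ℝ e
        ≈⟨ solve 7 (λ n a b c d e f →
             (a :* c :+ n :* (b :* d)) :* f :+ (a :* d :+ b :* c) :* e :=
             a :* (c :* f :+ d :* e) :+ b :* (c :* e :+ n :* (d :* f))) ℝ.refl n a b c d e f ⟩
      a *ℝ (c *ℝ f +ℝ d *ℝ e) +ℝ b *ℝ (c *ℝ e +ℝ n *ℝ (d *ℝ f))
        ≈⟨ +-congˡ (*-congˡ (ℝ.sym (x-y≈x+n*y ℝ.refl ℝ.refl))) ⟩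
      _ ∎

    comm-re : ∀ a b c d → (a *ℝ c -ℝ b *ℝ d) ≈ℝ (c *ℝ a -ℝ d *ℝ b)
    comm-re a b c d = +-cong (ℝ.*-comm a c) (ℝ.-‿cong (ℝ.*-comm b d))

    comm-im : ∀ a b c d → (a *ℝ d +ℝ b *ℝ c) ≈ℝ (c *ℝ b +ℝ d *ℝ a)
    comm-im a b c d = ℝ.trans (ℝ.+-comm _ _) (+-cong (ℝ.*-comm b c) (ℝ.*-comm a d))

    distribˡ-re : ∀ a b c d e f →
      (a *ℝ (c +ℝ e) -ℝ b *ℝ (d +ℝ f)) ≈ℝ ((a *ℝ c -ℝ b *ℝ d) +ℝ (a *ℝ e -ℝ b *ℝ f))
    distribˡ-re a b c d e f = begin
      _ ≈⟨ x-y≈x+n*y ℝ.refl ℝ.refl ⟩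
      a *ℝ (c +ℝ e) +ℝ n *ℝ (b *ℝ (d +ℝ f))
        ≈⟨ solve 7 (λ n a b c d e f →
             a :* (c :+ e) :+ n :* (b :* (d :+ f)) :=
             (a :* c :+ n :* (b :* d)) :+ (a :* e :+ n :* (b :* f))) ℝ.refl n a b c d e f ⟩
      (a *ℝ c +ℝ n *ℝ (b *ℝ d)) +ℝ (a *ℝ e +ℝ n *ℝ (b *ℝ f))
        ≈⟨ ℝ.sym (+-cong (x-y≈x+n*y ℝ.refl ℝ.refl) (x-y≈x+n*y ℝ.refl ℝ.refl)) ⟩
      _ ∎

    distribˡ-im : ∀ a b c d e f →
      (a *ℝ (d +ℝ f) +ℝ b *ℝ (c +ℝ e)) ≈ℝ ((a *ℝ d +ℝ b *ℝ c) +ℝ (a *ℝ f +ℝ b *ℝ e))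
    distribˡ-im = solve 6 (λ a b c d e f →
      a :* (d :+ f) :+ b :* (c :+ e) := (a :* d :+ b :* c) :+ (a :* f :+ b :* e)) ℝ.refl

    *-identityˡ-re : ∀ a b → (1# *ℝ a -ℝ ℝ.0# *ℝ b) ≈ℝ a
    *-identityˡ-re a b = ℝ.trans (x-y≈x+n*y (ℝ.*-identityˡ a) (ℝ.zeroˡ b))
      (ℝ.trans (+-congˡ (ℝ.zeroʳ n)) (ℝ.+-identityʳ a))

    *-identityˡ-im : ∀ a b → (1# *ℝ b +ℝ ℝ.0# *ℝ a) ≈ℝ b
    *-identityˡ-im a b = ℝ.trans (+-cong (ℝ.*-identityˡ b) (ℝ.zeroˡ a)) (ℝ.+-identityʳ b)

    *ℂ-comm : ∀ x y → x * y ≈ y * x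
    *ℂ-comm (a , b) (c , d) = comm-re a b c d , comm-im a b c d

    *ℂ-distribˡ : ∀ x y z → x * (y + z) ≈ x * y + x * z
    *ℂ-distribˡ (a , b) (c , d) (e , f) = distribˡ-re a b c d e f , distribˡ-im a b c d e f

    *ℂ-identityˡ : ∀ x → 1ℂ * x ≈ x
    *ℂ-identityˡ (a , b) = *-identityˡ-re a b , *-identityˡ-im a b

    +ℂ-cong : ∀ {x y u v} → x ≈ y → u ≈ v → x + u ≈ y + v
    +ℂ-cong (p , p′) (q , q′) = +-cong p q , +-cong p′ q′

  ≈-trans : ∀ {x y z} → x ≈ y → y ≈ z → x ≈ z
  ≈-trans (p , p′) (q , q′) = ℝ.trans p q , ℝ.trans p′ q′

  ℂ-isCommutativeRing : IsCommutativeRing _≈_ _+_ _*_ (λ x → 0ℂ - x) 0ℂ 1ℂ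
  ℂ-isCommutativeRing = record
    { isRing = record
      { +-isAbelianGroup = record
        { isGroup = record
          { isMonoid = record
            { isSemigroup = record
              { isMagma = record
                { isEquivalence = record
                  { refl  = ℝ.refl , ℝ.refl
                  ; sym   = λ (p , p′) → ℝ.sym p , ℝ.sym p′
                  ; trans = ≈-trans
                  }
                ; ∙-cong = +ℂ-cong
                }
              ; assoc = λ (a , b) (c , d) (e , f) → ℝ.+-assoc a c e , ℝ.+-assoc b d f
              }
            ; identity = (λ (a , b) → ℝ.+-identityˡ a , ℝ.+-identityˡ b)
                       , (λ (a , b) → ℝ.+-identityʳ a , ℝ.+-identityʳ b)
            }
          ; inverse = (λ (a , b) → 0-x+x≈0 a , 0-x+x≈0 b)
                    , (λ (a , b) → ℝ.trans (ℝ.+-comm _ _) (0-x+x≈0 a) , ℝ.trans (ℝ.+-comm _ _) (0-x+x≈0 b))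
          ; ⁻¹-cong = λ (p , p′) → +-congˡ (ℝ.-‿cong p) , +-congˡ (ℝ.-‿cong p′)
          }
        ; comm = λ (a , b) (c , d) → ℝ.+-comm a c , ℝ.+-comm b d
        }
      ; *-cong = λ (p , p′) (q , q′) →
          +-cong (*-cong p q) (ℝ.-‿cong (*-cong p′ q′)) , +-cong (*-cong p q′) (*-cong p′ q)
      ; *-assoc = λ (a , b) (c , d) (e , f) → assoc-re a b c d e f , assoc-im a b c d e f
      ; *-identity = *ℂ-identityˡ , λ x → ≈-trans (*ℂ-comm x 1ℂ) (*ℂ-identityˡ x)
      ; distrib = *ℂ-distribˡ , λ x y z → ≈-trans (*ℂ-comm (y + z) x)
          (≈-trans (*ℂ-distribˡ x y z) (+ℂ-cong (*ℂ-comm x y) (*ℂ-comm x z)))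
      }
    ; *-comm = *ℂ-comm
    }
    where
    0-x+x≈0 : ∀ a → ((ℝ.0# -ℝ a) +ℝ a) ≈ℝ ℝ.0#
    0-x+x≈0 a = ℝ.trans (+-cong (ℝ.+-identityˡ (- a)) ℝ.refl) (ℝ.-‿inverseˡ a)

  ℂ-commutativeRing : CommutativeRing 0ℓ 0ℓ
  ℂ-commutativeRing = record { isCommutativeRing = ℂ-isCommutativeRing }

  real-* : ∀ a b → real (a *ℝ b) ≈ real a * real b
  real-* a b = ℝ.sym (ℝ.trans (x-y≈x+n*y ℝ.refl (ℝ.zeroˡ ℝ.0#)) (ℝ.trans (+-congˡ (ℝ.zeroʳ n)) (ℝ.+-identityʳ _)))
             , ℝ.sym (ℝ.trans (+-cong (ℝ.zeroʳ a) (ℝ.zeroˡ b)) (ℝ.+-identityˡ ℝ.0#))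

  real-+ : ∀ a b → real (a +ℝ b) ≈ real a + real b
  real-+ a b = ℝ.refl , ℝ.sym (ℝ.+-identityˡ ℝ.0#)

-- Diagonal operators preserving a subspace, and interpolation among them.

module ComplexVectors (ℝ : CompleteOrderedField) where
  open Complex ℝ
  open ComplexRing ℝ
  private
    module ℝ = CompleteOrderedField ℝ
    module ℂ = CommutativeRing ℂ-commutativeRing
  open MonoidSum ℂ.+-monoid using (sum-cong-≋; sum-replicate-zero)
  open SetoidReasoning ℂ.setoid

  sum-zero : ∀ {n} (f : Vector ℂ n) → (∀ j → f j ≈ 0ℂ) → sumℂ f ≈ 0ℂ
  sum-zero {n} f f≈0 = ℂ.trans (sum-cong-≋ f≈0) (sum-replicate-zero n)

  sum-single : ∀ {n} (f : Vector ℂ n) i → (∀ j → j ≢ i → f j ≈ 0ℂ) → sumℂ f ≈ f i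
  sum-single f zero    f≈0 = ℂ.trans (ℂ.+-cong ℂ.refl (sum-zero _ λ j → f≈0 (suc j) λ ())) (ℂ.+-identityʳ _)
  sum-single f (suc i) f≈0 = ℂ.trans
    (ℂ.+-cong (f≈0 zero λ ()) (sum-single (f ∘ suc) i λ j j≢i → f≈0 (suc j) (j≢i ∘ Fin.suc-injective)))
    (ℂ.+-identityˡ _)

  ∑-lookup : ∀ {m n} (w : Fin m → Vector ℂ n) k → ∑ w k ≡ sumℂ λ j → w j k
  ∑-lookup {zero}  w k = ≡.refl
  ∑-lookup {suc m} w k = ≡.cong (λ z → w zero k + z) (∑-lookup (w ∘ suc) k)

  ∑-mem : ∀ {ℓ m n} {Ω : Pred (Vector ℂ n) ℓ} → IsSubspace Ω → (w : Fin m → Vector ℂ n) →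
          (∀ j → w j ∈ Ω) → ∑ w ∈ Ω
  ∑-mem {m = zero}  isΩ w w∈Ω = IsSubspace.0-mem isΩ
  ∑-mem {m = suc m} isΩ w w∈Ω = IsSubspace.+-closed isΩ (w∈Ω zero) (∑-mem isΩ (w ∘ suc) (w∈Ω ∘ suc))

  diag-∙ : ∀ {n} (d v : Vector ℂ n) → (diag d ∙ v) ≈ᵛ λ i → d i * v i
  diag-∙ d v i = ℂ.trans (sum-single _ i off-diagonal) (ℂ.*-congʳ (ℂ.reflexive diagonal))
    where
    off-diagonal : ∀ j → j ≢ i → diag d i j * v j ≈ 0ℂ
    off-diagonal j j≢i = ℂ.trans
      (ℂ.*-congʳ (ℂ.reflexive (≡.cong (if_then d i else 0ℂ) (dec-false (i Fin.≟ j) (j≢i ∘ ≡.sym)))))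
      (ℂ.zeroˡ _)
    diagonal : diag d i i ≡ d i
    diagonal = ≡.cong (if_then d i else 0ℂ) (dec-true (i Fin.≟ i) ≡.refl)

  -- This says that `diag f` maps `Ω` into itself. For a subspace `Ω` such `f` form an algebra under
  -- pointwise operations, so polynomials in diagonal matrices can be handled as functions, without
  -- matrix products.
  Stabilises : ∀ {n} → Pred (Vector ℂ n) 0ℓ → Vector ℂ n → Set
  Stabilises Ω f = ∀ {v} → v ∈ Ω → (λ k → f k * v k) ∈ Ω

  module _ {n : ℕ} {Ω : Pred (Vector ℂ n) 0ℓ} (isΩ : IsSubspace Ω) where
    private
      module Ω = IsSubspace isΩ

    stabilises-cong : ∀ {f g} → f ≈ᵛ g → Stabilises Ω f → Stabilises Ω g
    stabilises-cong f≈g Ωf v∈Ω = Ω.resp (λ k → ℂ.*-congʳ (f≈g k)) (Ωf v∈Ω)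

    stabilises-const : ∀ a → Stabilises Ω (λ _ → a)
    stabilises-const a = Ω.*-closed a

    stabilises-+ : ∀ {f g} → Stabilises Ω f → Stabilises Ω g → Stabilises Ω (λ k → f k + g k)
    stabilises-+ Ωf Ωg v∈Ω = Ω.resp (λ k → ℂ.sym (ℂ.distribʳ _ _ _)) (Ω.+-closed (Ωf v∈Ω) (Ωg v∈Ω))

    stabilises-* : ∀ {f g} → Stabilises Ω f → Stabilises Ω g → Stabilises Ω (λ k → f k * g k)
    stabilises-* Ωf Ωg v∈Ω = Ω.resp (λ k → ℂ.sym (ℂ.*-assoc _ _ _)) (Ωf (Ωg v∈Ω))

    -- One factor of a Lagrange interpolation polynomial; its values at the other points are left
    -- free.
    Separates : Pred (Fin n) 0ℓ → Fin n → Vector ℂ n → Set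
    Separates S u g = Stabilises Ω g × (∀ {s} → s ∈ S → g s ≈ 1ℂ) × g u ≈ 0ℂ

    -- The function is (d - b) / (a - b), an affine function of `d`.
    separates : ∀ {S : Pred (Fin n) 0ℓ} {d u} → Stabilises Ω d → ∀ a b → (∀ {s} → s ∈ S → d s ≈ real a) →
                d u ≈ real b → a ℝ.≉ b → ∃[ g ] Separates S u g
    separates {S} {d} {u} Ωd a b d-S d-u a≉b =
      (λ k → real c * (d k + real (ℝ.- b))) ,
      stabilises-* (stabilises-const (real c)) (stabilises-+ Ωd (stabilises-const (real (ℝ.- b)))) ,
      (λ s∈S → ℂ.trans (value a (d-S s∈S)) (ℝ.trans (ℝ.*-comm _ _) (ℝ.*-invʳ a-b≉0) , ℝ.refl)) ,
      ℂ.trans (value b d-u) (ℝ.trans (ℝ.*-congˡ (ℝ.-‿inverseʳ b)) (ℝ.zeroʳ c) , ℝ.refl)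
      where
      c = (a ℝ.- b) ℝ.⁻¹
      a-b≉0 : a ℝ.- b ℝ.≉ ℝ.0#
      a-b≉0 a-b≈0 = a≉b (ℝ.trans (ℝ.sym (ℝ.trans (ℝ.+-assoc a _ b) (ℝ.trans (ℝ.+-congˡ (ℝ.-‿inverseˡ b)) (ℝ.+-identityʳ a))))
        (ℝ.trans (ℝ.+-congʳ a-b≈0) (ℝ.+-identityˡ b)))
      value : ∀ {k} e → d k ≈ real e → real c * (d k + real (ℝ.- b)) ≈ real (c ℝ.* (e ℝ.- b))
      value {k} e d≈e = begin
        real c * (d k + real (ℝ.- b))      ≈⟨ ℂ.*-congˡ (ℂ.+-congʳ d≈e) ⟩
        real c * (real e + real (ℝ.- b))   ≈⟨ ℂ.*-congˡ (real-+ e (ℝ.- b)) ⟨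
        real c * real (e ℝ.- b)            ≈⟨ real-* c (e ℝ.- b) ⟨
        real (c ℝ.* (e ℝ.- b))             ∎

    private
      product : ∀ {S : Pred (Fin n) 0ℓ} {m} (g : Fin m → Vector ℂ n) → (∀ u → Stabilises Ω (g u)) →
                (∀ u {s} → s ∈ S → g u s ≈ 1ℂ) →
                ∃[ p ] Stabilises Ω p × (∀ {s} → s ∈ S → p s ≈ 1ℂ) × (∀ u k → g u k ≈ 0ℂ → p k ≈ 0ℂ)
      product {m = zero} g Ωg g≈1 = (λ _ → 1ℂ) , stabilises-const 1ℂ , (λ _ → ℂ.refl) , λ ()
      product {m = suc m} g Ωg g≈1 with product (g ∘ suc) (λ u {v} → Ωg (suc u) {v}) (λ u → g≈1 (suc u))
      ... | p , Ωp , p≈1 , p≈0 =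
        (λ k → g zero k * p k) , stabilises-* (Ωg zero) Ωp ,
        (λ s∈S → ℂ.trans (ℂ.*-cong (g≈1 zero s∈S) (p≈1 s∈S)) (ℂ.*-identityˡ 1ℂ)) ,
        λ { zero    k g≈0 → ℂ.trans (ℂ.*-congʳ g≈0) (ℂ.zeroˡ _)
          ; (suc u) k g≈0 → ℂ.trans (ℂ.*-congˡ (p≈0 u k g≈0)) (ℂ.zeroʳ _) }

    -- The indicator of S is the product of the functions separating S from the points outside.
    stabilises-indicator : ∀ {S : Pred (Fin n) 0ℓ} (S? : ∀ k → Dec (k ∈ S)) →
      (∀ u → ¬ u ∈ S → ∃[ g ] Separates S u g) →
      Stabilises Ω (λ k → if does (S? k) then 1ℂ else 0ℂ)
    stabilises-indicator {S} S? separating =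
      let p , Ωp , p≈1 , p≈0 = product factor (λ u {v} → factor-stabilises u {v}) factor≈1
      in stabilises-cong (λ k → evaluate p p≈1 p≈0 k (S? k)) Ωp
      where
      -- Points of `S` contribute the constant factor 1, which lets the product run over all of
      -- `Fin n`.
      choose : ∀ u → Dec (u ∈ S) → ∃[ g ] Stabilises Ω g × (∀ {s} → s ∈ S → g s ≈ 1ℂ) × (¬ u ∈ S → g u ≈ 0ℂ)
      choose u (yes u∈S) = (λ _ → 1ℂ) , stabilises-const 1ℂ , (λ _ → ℂ.refl) , λ u∉S → ⊥-elim (u∉S u∈S)
      choose u (no u∉S) with separating u u∉S
      ... | g , Ωg , g≈1 , g≈0 = g , Ωg , g≈1 , λ _ → g≈0

      factor : Fin n → Vector ℂ n
      factor u = proj₁ (choose u (S? u))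

      factor-stabilises : ∀ u → Stabilises Ω (factor u)
      factor-stabilises u = proj₁ (proj₂ (choose u (S? u)))

      factor≈1 : ∀ u {s} → s ∈ S → factor u s ≈ 1ℂ
      factor≈1 u = proj₁ (proj₂ (proj₂ (choose u (S? u))))

      evaluate : ∀ p → (∀ {s} → s ∈ S → p s ≈ 1ℂ) → (∀ u k → factor u k ≈ 0ℂ → p k ≈ 0ℂ) →
                 ∀ k (k? : Dec (k ∈ S)) → p k ≈ (if does k? then 1ℂ else 0ℂ)
      evaluate p p≈1 p≈0 k (yes k∈S) = p≈1 k∈S
      -- The factor belonging to `k` itself is the one that vanishes at `k`.
      evaluate p p≈1 p≈0 k (no k∉S)  = p≈0 k k (proj₂ (proj₂ (proj₂ (choose k (S? k)))) k∉S)

-- Only the disjointness of the sets P[ i , j ] matters here, so the subspace lattice is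
-- replaced by any finite set; the notions of Grassmann are its instances, with M = N ∸ D.
module GradedModules
  (em : ExcludedMiddle (lsuc 0ℓ)) (ℝ : CompleteOrderedField) {n m : ℕ}
  (vertex : Fin m → Fin n) (vertex-injective : ∀ y z → vertex y ≡ vertex z → y ≡ z)
  (P[_,_] : ℕ → ℕ → Pred (Fin n) 0ℓ)
  (P-unique : ∀ {u i j i′ j′} → u ∈ P[ i , j ] → u ∈ P[ i′ , j′ ] → i ≡ i′ × j ≡ j′)
  (D M : ℕ)
  where
  open Complex ℝ hiding (resp; 0-mem; add; scale; incl)
  open ComplexRing ℝ
  open ComplexVectors ℝ
  private
    module ℝ where
      open CompleteOrderedField ℝ public
      open OrderedFieldProperties ℝ public
    module ℂ = CommutativeRing ℂ-commutativeRing
  open MonoidSum ℂ.+-monoid using (sum-cong-≋)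

  V Ψ : Set
  V = Vector ℂ m
  Ψ = Vector ℂ n

  Iverson : Set → ℂ
  Iverson A = if does (em₀ em {A}) then 1ℂ else 0ℂ

  E*[_,_] : ℕ → ℕ → Mat n
  E*[ i , j ] = diag λ u → Iverson (u ∈ P[ i , j ])

  embed : V → Ψ
  embed v u = sumℂ λ y → Iverson (vertex y ≡ u) * v y

  tilde : Pred Ψ 0ℓ → Pred V 0ℓ
  tilde Ω v = embed v ∈ SumOf {n = n} {n = suc D} λ j → Image E*[ D ∸ toℕ j , toℕ j ] Ω

  Iverson-true : ∀ {A} → A → Iverson A ≡ 1ℂ
  Iverson-true a = ≡.cong (if_then 1ℂ else 0ℂ) (dec-true (em₀ em) a)

  Iverson-false : ∀ {A} → ¬ A → Iverson A ≡ 0ℂ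
  Iverson-false ¬a = ≡.cong (if_then 1ℂ else 0ℂ) (dec-false (em₀ em) ¬a)

  E*-∙ : ∀ i j (w : Ψ) u → (E*[ i , j ] ∙ w) u ≈ Iverson (u ∈ P[ i , j ]) * w u
  E*-∙ i j = diag-∙ λ u → Iverson (u ∈ P[ i , j ])

  Iverson-false-* : ∀ {A} → ¬ A → ∀ z → Iverson A * z ≈ 0ℂ
  Iverson-false-* ¬a z = ℂ.trans (ℂ.*-congʳ (ℂ.reflexive (Iverson-false ¬a))) (ℂ.zeroˡ z)

  Iverson-true-* : ∀ {A} → A → ∀ z → Iverson A * z ≈ z
  Iverson-true-* a z = ℂ.trans (ℂ.*-congʳ (ℂ.reflexive (Iverson-true a))) (ℂ.*-identityˡ z)

  -- The diagonal entries of `K₁` and `K₂`.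

  entry : ℝ.Carrier → (ℕ → ℕ → ℤ) → Fin n → Fin (suc D) → Fin (suc M) → ℂ
  entry b e u i j = Iverson (u ∈ P[ toℕ i , toℕ j ]) * real (b ℝ.^ℤ e (toℕ i) (toℕ j))

  -- The diagonal of K₁ for b = √ q and e i j = D - 2i, and similarly for K₂.
  κ : ℝ.Carrier → (ℕ → ℕ → ℤ) → Ψ
  κ b e u = sumℂ λ i → sumℂ (entry b e u i)

  InGrid : Fin n → Set
  InGrid u = ∃₂ λ i j → i ≤ D × j ≤ M × u ∈ P[ i , j ]

  κ-outside : ∀ b e {u} → ¬ InGrid u → κ b e u ≈ real ℝ.0#
  κ-outside b e {u} u∉ = sum-zero (λ i → sumℂ (entry b e u i)) λ i → sum-zero (entry b e u i) λ j → Iverson-false-*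
    (λ u∈ → u∉ (toℕ i , toℕ j , Fin.toℕ≤pred[n] i , Fin.toℕ≤pred[n] j , u∈)) _

  -- By disjointness, `u` lies in no other set of the grading, so both sums collapse to a single
  -- term.
  κ-inside : ∀ b e {u i j} → i ≤ D → j ≤ M → u ∈ P[ i , j ] → κ b e u ≈ real (b ℝ.^ℤ e i j)
  κ-inside b e {u} {i} {j} i≤D j≤M u∈ = begin
    κ b e u                  ≈⟨ sum-single (λ i → sumℂ (entry b e u i)) i′ (λ k k≢i′ → sum-zero (entry b e u k) λ l →
                                  Iverson-false-* (λ u∈′ → k≢i′ (i′-unique (proj₁ (P-unique u∈ u∈′)))) _) ⟩
    sumℂ (entry b e u i′)    ≈⟨ sum-single (entry b e u i′) j′ (λ l l≢j′ →
                                  Iverson-false-* (λ u∈′ → l≢j′ (j′-unique (proj₂ (P-unique u∈ u∈′)))) _) ⟩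
    entry b e u i′ j′        ≡⟨ ≡.cong₂ (λ k l → Iverson (u ∈ P[ k , l ]) * real (b ℝ.^ℤ e k l)) toℕ-i′ toℕ-j′ ⟩
    Iverson (u ∈ P[ i , j ]) * real (b ℝ.^ℤ e i j) ≈⟨ Iverson-true-* u∈ _ ⟩
    real (b ℝ.^ℤ e i j)      ∎
    where
    open SetoidReasoning ℂ.setoid
    i′ = fromℕ< (s≤s i≤D)
    j′ = fromℕ< (s≤s j≤M)
    toℕ-i′ = Fin.toℕ-fromℕ< (s≤s i≤D)
    toℕ-j′ = Fin.toℕ-fromℕ< (s≤s j≤M)
    i′-unique : ∀ {k} → i ≡ toℕ k → k ≡ i′
    i′-unique i≡k = Fin.toℕ-injective (≡.trans (≡.sym i≡k) (≡.sym toℕ-i′))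
    j′-unique : ∀ {l} → j ≡ toℕ l → l ≡ j′
    j′-unique j≡l = Fin.toℕ-injective (≡.trans (≡.sym j≡l) (≡.sym toℕ-j′))

  -- Extension by zero and the passage from `Ω` to `tilde Ω`.

  embed-injective : ∀ {v} → embed v ≈ᵛ (λ _ → 0ℂ) → v ≈ᵛ (λ _ → 0ℂ)
  embed-injective {v} ev≈0 y = ℂ.trans (ℂ.sym (ℂ.trans
    (sum-single _ y λ z z≢y → Iverson-false-* (λ eq → z≢y (vertex-injective z y eq)) _)
    (Iverson-true-* ≡.refl (v y)))) (ev≈0 (vertex y))

  tilde-mono : ∀ {Ω Ω′ : Pred Ψ 0ℓ} → Ω ⊆ Ω′ → tilde Ω ⊆ tilde Ω′
  tilde-mono Ω⊆Ω′ (w , w∈ , v≈∑w) = w , (λ j → let (ω , ω∈ , eq) = w∈ j in ω , Ω⊆Ω′ ω∈ , eq) , v≈∑w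

  -- The projections of a vector of Ω̃ are those of its extension by zero.
  tilde-transfer : ∀ {Ω Ω′ : Pred Ψ 0ℓ} {v} → v ∈ tilde Ω → embed v ∈ Ω′ → v ∈ tilde Ω′
  tilde-transfer {Ω} {v = v} (w , w∈ , v≈∑w) ev∈Ω′ =
    (λ (j : Fin (suc D)) → E*[ D ∸ toℕ j , toℕ j ] ∙ embed v) , (λ j → embed v , ev∈Ω′ , λ _ → ℂ.refl) , λ u → begin
      embed v u                                                  ≈⟨ v≈∑w u ⟩
      ∑ w u                                                      ≡⟨ ∑-lookup {suc D} w u ⟩
      sumℂ (λ j → w j u)                                         ≈⟨ sum-cong-≋ {suc D} (component u) ⟨
      sumℂ (λ (j : Fin (suc D)) → (E*[ D ∸ toℕ j , toℕ j ] ∙ embed v) u)         ≡⟨ ∑-lookup {suc D} (λ (j : Fin (suc D)) → E*[ D ∸ toℕ j , toℕ j ] ∙ embed v) u ⟨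
      ∑ (λ (j : Fin (suc D)) → E*[ D ∸ toℕ j , toℕ j ] ∙ embed v) u              ∎
    where
    open SetoidReasoning ℂ.setoid

    w-entry : ∀ j u → w j u ≈ Iverson (u ∈ P[ D ∸ toℕ j , toℕ j ]) * proj₁ (w∈ j) u
    w-entry j u = ℂ.trans (proj₂ (proj₂ (w∈ j)) u) (E*-∙ _ _ (proj₁ (w∈ j)) u)

    component : ∀ u j → (E*[ D ∸ toℕ j , toℕ j ] ∙ embed v) u ≈ w j u
    component u j = ℂ.trans (E*-∙ _ _ (embed v) u) (cases (em₀ em))
      where
      cases : Dec (u ∈ P[ D ∸ toℕ j , toℕ j ]) → Iverson (u ∈ P[ D ∸ toℕ j , toℕ j ]) * embed v u ≈ w j u
      cases (no u∉) = ℂ.trans (Iverson-false-* u∉ _) (ℂ.sym (ℂ.trans (w-entry j u) (Iverson-false-* u∉ _)))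
      -- Distinct summands have distinct second indices, so at this `u` every component other than
      -- `w j` vanishes.
      cases (yes u∈) = begin
        Iverson (u ∈ P[ D ∸ toℕ j , toℕ j ]) * embed v u   ≈⟨ Iverson-true-* u∈ _ ⟩
        embed v u                                          ≈⟨ v≈∑w u ⟩
        ∑ w u                                              ≡⟨ ∑-lookup {suc D} w u ⟩
        sumℂ (λ k → w k u)                                 ≈⟨ sum-single _ j (λ k k≢j → ℂ.trans (w-entry k u)
                                                                (Iverson-false-* (λ u∈′ → k≢j (Fin.toℕ-injective (proj₂ (P-unique u∈′ u∈)))) _)) ⟩
        w j u                                              ∎

  -- Coordinate vectors inside a graded component.

  unit : Fin n → Ψ
  unit u v = Iverson (u ≡ v)

  unit-mem : ∀ {Ω : Pred Ψ 0ℓ} {i j u} → (∀ ψ → ψ ∈ Ω) → u ∈ P[ i , j ] → unit u ∈ Image E*[ i , j ] Ω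
  unit-mem {i = i} {j} {u} full u∈ = unit u , full (unit u) , λ v → ℂ.sym (ℂ.trans (E*-∙ _ _ (unit u) v) (value v (em₀ em)))
    where
    value : ∀ v → Dec (u ≡ v) → Iverson (v ∈ P[ i , j ]) * unit u v ≈ unit u v
    value v (yes ≡.refl) = Iverson-true-* u∈ _
    value v (no u≢v)     = ℂ.trans (ℂ.*-congˡ (ℂ.reflexive (Iverson-false u≢v)))
      (ℂ.trans (ℂ.zeroʳ _) (ℂ.sym (ℂ.reflexive (Iverson-false u≢v))))

  -- Suppose one vector `b₀` spanned both, with coefficients `a` and `c`. Then `a * b₀ u` and
  -- `c * b₀ v` are 1 while `c * b₀ u` is 0, and regrouping the product of the first two exhibits
  -- the third as a factor. With an empty basis, `unit u` would vanish at `u`.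
  units-dim>1 : ∀ {S : Pred Ψ 0ℓ} {u v d} → unit u ∈ S → unit v ∈ S → u ≢ v → HasDimension S d → ¬ d ≤ 1
  units-dim>1 {S} {u} {v} u∈S v∈S u≢v (b , _ , _ , spans) d≤1 = 1≉0 (spans′ d≤1 b spans)
    where
    open SetoidReasoning ℂ.setoid
    1≉0 : ¬ 1ℂ ≈ 0ℂ
    1≉0 (e , _) = ℝ.1≉0 e

    spans′ : ∀ {d} → d ≤ 1 → (b : Fin d → Ψ) → (∀ w → w ∈ S → ∃[ c ] w ≈ᵛ combination c b) → 1ℂ ≈ 0ℂ
    spans′ z≤n b spans =
      let _ , eq = spans (unit u) u∈S
      in ℂ.trans (ℂ.sym (ℂ.reflexive (Iverson-true ≡.refl))) (eq u)
    spans′ (s≤s z≤n) b spans = begin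
      1ℂ                                ≈⟨ ℂ.*-identityʳ 1ℂ ⟨
      1ℂ * 1ℂ                           ≈⟨ ℂ.*-cong (on eu u ≡.refl) (on ev v ≡.refl) ⟨
      (a * b₀ u) * (c * b₀ v)           ≈⟨ ℂ.*-congˡ (ℂ.*-comm c (b₀ v)) ⟩
      (a * b₀ u) * (b₀ v * c)           ≈⟨ ℂ.*-assoc a (b₀ u) _ ⟩
      a * (b₀ u * (b₀ v * c))           ≈⟨ ℂ.*-congˡ (ℂ.*-comm (b₀ u) _) ⟩
      a * ((b₀ v * c) * b₀ u)           ≈⟨ ℂ.*-congˡ (ℂ.*-assoc (b₀ v) c (b₀ u)) ⟩
      a * (b₀ v * (c * b₀ u))           ≈⟨ ℂ.*-congˡ (ℂ.*-congˡ (off ev u (u≢v ∘ ≡.sym))) ⟩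
      a * (b₀ v * 0ℂ)                   ≈⟨ ℂ.trans (ℂ.*-congˡ (ℂ.zeroʳ _)) (ℂ.zeroʳ a) ⟩
      0ℂ                                ∎
      where
      b₀ = b zero
      a = proj₁ (spans (unit u) u∈S) zero
      c = proj₁ (spans (unit v) v∈S) zero
      eu = proj₂ (spans (unit u) u∈S)
      ev = proj₂ (spans (unit v) v∈S)
      on : ∀ {s w} → unit s ≈ᵛ (λ k → w * b₀ k + 0ℂ) → ∀ k → s ≡ k → w * b₀ k ≈ 1ℂ
      on e k s≡k = ℂ.trans (ℂ.sym (ℂ.trans (e k) (ℂ.+-identityʳ _))) (ℂ.reflexive (Iverson-true s≡k))
      off : ∀ {s w} → unit s ≈ᵛ (λ k → w * b₀ k + 0ℂ) → ∀ k → s ≢ k → w * b₀ k ≈ 0ℂ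
      off e k s≢k = ℂ.trans (ℂ.sym (ℂ.trans (e k) (ℂ.+-identityʳ _))) (ℂ.reflexive (Iverson-false s≢k))

  ∩-isModule : ∀ {ℋ : Pred (Mat n) 0ℓ} {Ω Ω′ : Pred Ψ 0ℓ} → IsModule ℋ Ω → IsModule ℋ Ω′ → IsModule ℋ (Ω ∩ Ω′)
  ∩-isModule Ω-module Ω′-module = record
    { isSubspace = record
      { resp     = λ e (m , m′) → M.resp e m , M′.resp e m′
      ; 0-mem    = M.0-mem , M′.0-mem
      ; +-closed = λ (m , m′) (n , n′) → M.+-closed m n , M′.+-closed m′ n′
      ; *-closed = λ a (m , m′) → M.*-closed a m , M′.*-closed a m′
      }
    ; invariant = λ H∈ℋ (m , m′) →
        IsModule.invariant Ω-module H∈ℋ m , IsModule.invariant Ω′-module H∈ℋ m′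
    }
    where
    module M = IsSubspace (IsModule.isSubspace Ω-module)
    module M′ = IsSubspace (IsModule.isSubspace Ω′-module)

  -- Modules stable under the graded projections, and the two implications.

  module Stable (b : ℝ.Carrier) (1≤b : ℝ.1# ℝ.≤ b) (b≉1 : b ℝ.≉ ℝ.1#) (c₁ c₂ : ℤ)
    (ℋ : Pred (Mat n) 0ℓ)
    (K₁∈ℋ : diag (κ b λ i j → c₁ ℤ.- + 2 ℤ.* + i) ∈ ℋ)
    (K₂∈ℋ : diag (κ b λ i j → c₂ ℤ.- + 2 ℤ.* + j) ∈ ℋ)
    where

    b^-distinct : ∀ {e f} → e ≢ f → b ℝ.^ℤ e ℝ.≉ b ℝ.^ℤ f
    b^-distinct e≢f eq = e≢f (ℝ.^ℤ-injective 1≤b b≉1 eq)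

    module _ {Ω : Pred Ψ 0ℓ} (Ω-module : IsModule ℋ Ω) where
      open IsModule Ω-module

      stabilises-κ : ∀ e → diag (κ b e) ∈ ℋ → Stabilises Ω (κ b e)
      stabilises-κ e K∈ℋ v∈Ω = IsSubspace.resp isSubspace (diag-∙ (κ b e) _) (invariant K∈ℋ v∈Ω)

      stabilises-E* : ∀ {i j} → i ≤ D → j ≤ M → Stabilises Ω (λ u → Iverson (u ∈ P[ i , j ]))
      stabilises-E* {i} {j} i≤D j≤M = stabilises-indicator isSubspace {S = P[ i , j ]} (λ _ → em₀ em) separating
        where
        e₁ e₂ : ℕ → ℕ → ℤ
        e₁ i j = c₁ ℤ.- + 2 ℤ.* + i
        e₂ i j = c₂ ℤ.- + 2 ℤ.* + j

        b^ : ℤ → ℝ.Carrier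
        b^ e = b ℝ.^ℤ e

        -- Outside the grid the entry 0 of `K₁` differs from a power of `b`. Inside it, `K₁` detects
        -- a different first index, and `K₂` a different second index when the first ones agree.
        separating : ∀ u → u ∉ P[ i , j ] → ∃[ g ] Separates isSubspace P[ i , j ] u g
        separating u u∉ with em₀ em {InGrid u}
        ... | no outside = separates isSubspace (stabilises-κ e₁ (K₁∈ℋ)) (b^ (e₁ i j)) ℝ.0#
                (κ-inside b e₁ i≤D j≤M) (κ-outside b e₁ outside) (ℝ.^ℤ-nonzero (ℝ.1≤x⇒x≉0 1≤b) (e₁ i j))
        ... | yes (i′ , j′ , i′≤D , j′≤M , u∈) with i ℕ.≟ i′ | j ℕ.≟ j′
        ...   | yes ≡.refl | yes ≡.refl = ⊥-elim (u∉ u∈)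
        ...   | no i≢i′ | _ = separates isSubspace (stabilises-κ e₁ (K₁∈ℋ)) (b^ (e₁ i j)) (b^ (e₁ i′ j′))
                (κ-inside b e₁ i≤D j≤M) (κ-inside b e₁ i′≤D j′≤M u∈)
                (b^-distinct (i≢i′ ∘ [c-2m]-injective c₁))
        ...   | yes _ | no j≢j′ = separates isSubspace (stabilises-κ e₂ (K₂∈ℋ)) (b^ (e₂ i j)) (b^ (e₂ i′ j′))
                (κ-inside b e₂ i≤D j≤M) (κ-inside b e₂ i′≤D j′≤M u∈)
                (b^-distinct (j≢j′ ∘ [c-2m]-injective c₂))

      E*-image⊆ : ∀ {i j} → i ≤ D → j ≤ M → Image E*[ i , j ] Ω ⊆ Ω
      E*-image⊆ i≤D j≤M (w , w∈Ω , v≈E*w) = IsSubspace.resp isSubspace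
        (λ u → ℂ.sym (ℂ.trans (v≈E*w u) (E*-∙ _ _ w u))) (stabilises-E* i≤D j≤M w∈Ω)

      -- Each summand lies in the image of one projection, and `D ≤ M` keeps all the positions
      -- `(D - j , j)` in the range where projections preserve `Ω`.
      tilde-embed : D ≤ M → ∀ {v} → v ∈ tilde Ω → embed v ∈ Ω
      tilde-embed D≤M (w , w∈ , v≈∑w) = IsSubspace.resp isSubspace (λ u → ℂ.sym (v≈∑w u))
        (∑-mem isSubspace w λ j → E*-image⊆ (ℕ.m∸n≤m D (toℕ j)) (ℕ.≤-trans (Fin.toℕ≤pred[n] j) D≤M) (w∈ j))

    _^ℋ : Pred V 0ℓ → Pred Ψ (lsuc 0ℓ)
    (W ^ℋ) ψ = (Ω : Pred Ψ 0ℓ) → IsModule ℋ Ω → tilde Ω ≐ W → ψ ∈ Ω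

    tilde≐⇒≐^ℋ : D ≤ M → ∀ {W : Pred V 0ℓ} → Nonzero W → ∀ {Ω : Pred Ψ 0ℓ} → IsIrreducible ℋ Ω →
                 tilde Ω ≐ W → Ω ≐ (W ^ℋ)
    tilde≐⇒≐^ℋ D≤M {W} (w , w∈W , w≉0) {Ω} Ω-irreducible Ω̃≐W =
      Ω⊆W^ℋ , λ ψ∈ → ψ∈ Ω isModule Ω̃≐W
      where
      open IsIrreducible Ω-irreducible

      Ω⊆W^ℋ : Ω ⊆ (W ^ℋ)
      Ω⊆W^ℋ ψ∈Ω Ω′ Ω′-module Ω̃′≐W =
        -- A zero intersection would force `embed w`, hence `w`, to vanish.
        [ (λ Ω∩Ω′≈0 → ⊥-elim (w≉0 (embed-injective (Ω∩Ω′≈0 (embed w)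
            (tilde-embed isModule D≤M (proj₂ Ω̃≐W w∈W) , tilde-embed Ω′-module D≤M (proj₂ Ω̃′≐W w∈W))))))
        , (λ Ω∩Ω′≐Ω → proj₂ (proj₂ Ω∩Ω′≐Ω ψ∈Ω))
        ]′ (simple (Ω ∩ Ω′) (∩-isModule isModule Ω′-module) proj₁)

    -- One inclusion is monotonicity, as `Ω` lies in the competitor `Ω₀`. For the other, `embed w`
    -- belongs to every competitor and hence to `Ω`; membership in `tilde Ω₀` supplies the
    -- information that `embed w` is the sum of its own projections.
    ^ℋ≐⇒tilde≐ : D ≤ M → ∀ {W : Pred V 0ℓ} {Ω Ω₀ : Pred Ψ 0ℓ} → IsModule ℋ Ω₀ → tilde Ω₀ ≐ W →
                 Ω ≐ (W ^ℋ) → tilde Ω ≐ W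
    ^ℋ≐⇒tilde≐ D≤M {W} {Ω} {Ω₀} Ω₀-module Ω̃₀≐W (Ω⊆W^ℋ , W^ℋ⊆Ω) =
      (λ v∈ → proj₁ Ω̃₀≐W (tilde-mono {Ω} {Ω₀} (λ ψ∈ → Ω⊆W^ℋ ψ∈ Ω₀ Ω₀-module Ω̃₀≐W) v∈)) ,
      λ {w} w∈W → tilde-transfer {Ω₀} {Ω} (proj₂ Ω̃₀≐W w∈W)
        (W^ℋ⊆Ω λ Ω′ Ω′-module Ω̃′≐W → tilde-embed Ω′-module D≤M (proj₂ Ω̃′≐W w∈W))

-- Dimension over a finite field, by counting.

module Dimension (F : Field) {q : ℕ} (card : HasCardinality (Field.setoid F) q) (2≤q : 2 ≤ q)
                 (𝒱 : FieldModule F) where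
  open VectorSpace F 𝒱
  open LeftModule 𝒱
  private
    module F = Field F
    module card = Inverse card
    open MonoidSum +ᴹ-monoid using (sum-cong-≋; sum-replicate-zero)
    open CommutativeMonoidSum +ᴹ-commutativeMonoid using (∑-distrib-+)
    open GroupProperties F.+-group using (x∙y⁻¹≈ε⇒x≈y)
    open SetoidReasoning ≈ᴹ-setoid

  combination-congˡ : ∀ {n} {c c′ : Vector F.Carrier n} (b : Vector Carrierᴹ n) →
                      (∀ k → c k F.≈ c′ k) → combination c b ≈ᴹ combination c′ b
  combination-congˡ b c≈c′ = sum-cong-≋ λ k → *ₗ-congʳ (c≈c′ k)

  combination-+ : ∀ {n} (c c′ : Vector F.Carrier n) (b : Vector Carrierᴹ n) →
                  combination (λ k → c k F.+ c′ k) b ≈ᴹ combination c b +ᴹ combination c′ b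
  combination-+ c c′ b = ≈ᴹ-trans (sum-cong-≋ λ k → *ₗ-distribʳ (b k) (c k) (c′ k)) (∑-distrib-+ (λ k → c k *ₗ b k) (λ k → c′ k *ₗ b k))

  coordinates-unique : ∀ {n} {b : Vector Carrierᴹ n} → LinearlyIndependent b → ∀ c c′ →
                       combination c b ≈ᴹ combination c′ b → ∀ k → c k F.≈ c′ k
  coordinates-unique {n} {b} indep c c′ eq k = x∙y⁻¹≈ε⇒x≈y (c k) (c′ k) (indep _ (begin
    combination (λ k → c k F.+ -c′ k) b            ≈⟨ combination-+ c -c′ b ⟩
    combination c b +ᴹ combination -c′ b           ≈⟨ +ᴹ-congʳ eq ⟩
    combination c′ b +ᴹ combination -c′ b          ≈⟨ combination-+ c′ -c′ b ⟨
    combination (λ k → c′ k F.+ -c′ k) b           ≈⟨ sum-cong-≋ (λ k → ≈ᴹ-trans (*ₗ-congʳ (F.-‿inverseʳ (c′ k))) (*ₗ-zeroˡ (b k))) ⟩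
    ∑ {n} (λ _ → 0ᴹ)                               ≈⟨ sum-replicate-zero n ⟩
    0ᴹ                                             ∎) k)
    where
    -c′ = λ k → F.- c′ k

  combination-mem : ∀ {ℓ n} {S : Pred Carrierᴹ ℓ} → IsSubspace S → ∀ c {b : Vector Carrierᴹ n} →
                    (∀ k → b k ∈ S) → combination c b ∈ S
  combination-mem {n = zero}  isS c b∈S = IsSubspace.0-mem isS
  combination-mem {n = suc n} isS c b∈S = IsSubspace.+-closed isS
    (IsSubspace.*-closed isS (c zero) (b∈S zero)) (combination-mem isS (c ∘ suc) (b∈S ∘ suc))

  -- A d-dimensional subspace has q ^ d elements.
  dimension-mono : ∀ {ℓ ℓ′ d d′} {S : Pred Carrierᴹ ℓ} {S′ : Pred Carrierᴹ ℓ′} → IsSubspace S → S ⊆ S′ →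
                   HasDimension S d → HasDimension S′ d′ → d ≤ d′
  dimension-mono {d = d} {d′} isS S⊆S′ (b , b∈S , b-indep , _) (b′ , _ , _ , b′-spans) =
    -- If `d′ < d`, then reading the vectors of `S` in coordinates over `b′` would inject `q ^ d`
    -- codes into the fewer `q ^ d′` codes.
    ℕ.≮⇒≥ λ d′<d → ℕ.<⇒≱ (ℕ.^-monoʳ-< q 2≤q d′<d) (Fin.injective⇒≤ encode-injective)
    where
    vector : Fin (q ℕ.^ d) → Carrierᴹ
    vector s = combination (card.to ∘ finToFun s) b

    coordinates : ∀ s → ∃[ c ] vector s ≈ᴹ combination c b′
    coordinates s = b′-spans (vector s) (S⊆S′ (combination-mem isS _ b∈S))

    encode : Fin (q ℕ.^ d) → Fin (q ℕ.^ d′)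
    encode s = funToFin (card.from ∘ proj₁ (coordinates s))

    encode-coordinates : ∀ s k → card.to (finToFun (encode s) k) F.≈ proj₁ (coordinates s) k
    encode-coordinates s k = card.inverseˡ (Fin.finToFun-funToFin (card.from ∘ proj₁ (coordinates s)) k)

    encode-injective : Injective _≡_ _≡_ encode
    encode-injective {s} {t} eq = ≡.trans (≡.sym (Fin.funToFin-finToFin {d} {q} s))
      (≡.trans (funToFin-cong λ k → to-injective (coordinates-unique b-indep _ _ vector-eq k)) (Fin.funToFin-finToFin {d} {q} t))
      where
      funToFin-cong : ∀ {m n} {f g : Fin m → Fin n} → (∀ k → f k ≡ g k) → funToFin f ≡ funToFin g
      funToFin-cong {zero}  f≗g = ≡.refl
      funToFin-cong {suc m} f≗g = ≡.cong₂ combine (f≗g zero) (funToFin-cong (f≗g ∘ suc))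

      to-injective : ∀ {x y} → card.to x F.≈ card.to y → x ≡ y
      to-injective e = ≡.trans (≡.sym (card.inverseʳ F.refl)) (card.inverseʳ e)

      vector-eq : vector s ≈ᴹ vector t
      vector-eq = begin
        vector s                                        ≈⟨ proj₂ (coordinates s) ⟩
        combination (proj₁ (coordinates s)) b′          ≈⟨ combination-congˡ b′ (encode-coordinates s) ⟨
        combination (card.to ∘ finToFun (encode s)) b′  ≡⟨ ≡.cong (λ e → combination (card.to ∘ finToFun e) b′) eq ⟩
        combination (card.to ∘ finToFun (encode t)) b′  ≈⟨ combination-congˡ b′ (encode-coordinates t) ⟩
        combination (proj₁ (coordinates t)) b′          ≈⟨ proj₂ (coordinates t) ⟨
        vector t                                        ∎

  dimension-unique : ∀ {ℓ d d′} {S : Pred Carrierᴹ ℓ} → IsSubspace S →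
                     HasDimension S d → HasDimension S d′ → d ≡ d′
  dimension-unique isS h h′ =
    ℕ.≤-antisym (dimension-mono isS (λ z → z) h h′) (dimension-mono isS (λ z → z) h′ h)

  dimension-≐ : ∀ {ℓ ℓ′ d} {S : Pred Carrierᴹ ℓ} {S′ : Pred Carrierᴹ ℓ′} → S ≐ S′ →
                HasDimension S d → HasDimension S′ d
  dimension-≐ (S⊆S′ , S′⊆S) (b , b∈S , indep , spans) =
    b , (λ k → S⊆S′ (b∈S k)) , indep , λ v v∈S′ → spans v (S′⊆S v∈S′)

  ∩-isSubspace : ∀ {ℓ ℓ′} {S : Pred Carrierᴹ ℓ} {S′ : Pred Carrierᴹ ℓ′} →
                 IsSubspace S → IsSubspace S′ → IsSubspace (λ v → v ∈ S × v ∈ S′)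
  ∩-isSubspace isS isS′ = record
    { resp     = λ e (m , m′) → S.resp e m , S′.resp e m′
    ; 0-mem    = S.0-mem , S′.0-mem
    ; +-closed = λ (m , m′) (n , n′) → S.+-closed m n , S′.+-closed m′ n′
    ; *-closed = λ a (m , m′) → S.*-closed a m , S′.*-closed a m′
    }
    where
    module S = IsSubspace isS
    module S′ = IsSubspace isS′

  Line : Carrierᴹ → Pred Carrierᴹ 0ℓ
  Line v w = ∃[ a ] w ≈ᴹ a *ₗ v

  line-isSubspace : ∀ v → IsSubspace (Line v)
  line-isSubspace v = record
    { resp     = λ e (a , w≈) → a , ≈ᴹ-trans (≈ᴹ-sym e) w≈
    ; 0-mem    = F.0# , ≈ᴹ-sym (*ₗ-zeroˡ v)
    ; +-closed = λ (a , e) (a′ , e′) → a F.+ a′ , ≈ᴹ-trans (+ᴹ-cong e e′) (≈ᴹ-sym (*ₗ-distribʳ v a a′))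
    ; *-closed = λ c (a , e) → c F.* a , ≈ᴹ-trans (*ₗ-congˡ e) (≈ᴹ-sym (*ₗ-assoc c a v))
    }

-- Lines that meet `x` only in zero.

module TransversalLines (em : ExcludedMiddle 0ℓ) (F : Field) {q : ℕ} (card : HasCardinality (Field.setoid F) q)
  (2≤q : 2 ≤ q) (𝒱 : FieldModule F) {N : ℕ} (dim𝒱 : HasDimension𝒱 F 𝒱 N)
  {D : ℕ} {x : Pred (LeftModule.Carrierᴹ 𝒱) 0ℓ} (isx : VectorSpace.IsSubspace F 𝒱 x)
  (x-dim : VectorSpace.HasDimension F 𝒱 x D)
  where
  open VectorSpace F 𝒱
  open Dimension F card 2≤q 𝒱
  private
    module 𝒱 = LeftModule 𝒱
    module F = Field F
    module x = IsSubspace isx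

  -- An invertible `a` would put `v`, as a multiple of `w`, into `x`.
  scalar≈0 : ∀ {v w a} → v ∉ x → w 𝒱.≈ᴹ a 𝒱.*ₗ v → w ∈ x → a F.≈ F.0#
  scalar≈0 {v} {w} {a} v∉x w≈av w∈x with em {a F.≈ F.0#}
  ... | yes a≈0 = a≈0
  ... | no a≉0 = ⊥-elim (v∉x (x.resp a⁻¹w≈v (x.*-closed (a F.⁻¹) w∈x)))
    where
    open SetoidReasoning 𝒱.≈ᴹ-setoid
    a⁻¹w≈v : (a F.⁻¹) 𝒱.*ₗ w 𝒱.≈ᴹ v
    a⁻¹w≈v = begin
      (a F.⁻¹) 𝒱.*ₗ w            ≈⟨ 𝒱.*ₗ-congˡ w≈av ⟩
      (a F.⁻¹) 𝒱.*ₗ (a 𝒱.*ₗ v)   ≈⟨ 𝒱.*ₗ-assoc (a F.⁻¹) a v ⟨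
      (a F.⁻¹ F.* a) 𝒱.*ₗ v      ≈⟨ 𝒱.*ₗ-congʳ (F.trans (F.*-comm _ a) (F.*-invʳ a≉0)) ⟩
      F.1# 𝒱.*ₗ v                ≈⟨ 𝒱.*ₗ-identityˡ v ⟩
      v                          ∎

  v∈Line : ∀ v → v ∈ Line v
  v∈Line v = F.1# , 𝒱.≈ᴹ-sym (𝒱.*ₗ-identityˡ v)

  line∩x : ∀ {v} → v ∉ x → HasDimension (Line v ∩ x) 0
  line∩x {v} v∉x = (λ ()) , (λ ()) , (λ _ _ ()) , λ w ((a , w≈av) , w∈x) →
    (λ ()) , 𝒱.≈ᴹ-trans w≈av (𝒱.≈ᴹ-trans (𝒱.*ₗ-congʳ (scalar≈0 v∉x w≈av w∈x)) (𝒱.*ₗ-zeroˡ v))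

  line-dim : ∀ {v} → v ∉ x → HasDimension (Line v) 1
  line-dim {v} v∉x = (λ _ → v) , (λ _ → v∈Line v) ,
    (λ { c eq zero → scalar≈0 v∉x (𝒱.≈ᴹ-sym (𝒱.≈ᴹ-trans (𝒱.≈ᴹ-sym (𝒱.+ᴹ-identityʳ _)) eq)) x.0-mem }) ,
    λ w (a , w≈av) → (λ _ → a) , 𝒱.≈ᴹ-trans w≈av (𝒱.≈ᴹ-sym (𝒱.+ᴹ-identityʳ _))

  outside : D < N → ∃[ v ] v ∉ x
  outside D<N with em {∃[ v ] v ∉ x}
  ... | yes v∉x = v∉x
  ... | no ¬v∉x = ⊥-elim (ℕ.<⇒≱ D<N (dimension-mono U-isSubspace U⊆x dim𝒱 (x-dim)))
    where
    U-isSubspace : IsSubspace U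
    U-isSubspace = record { resp = λ _ _ → tt ; 0-mem = tt ; +-closed = λ _ _ → tt ; *-closed = λ _ _ → tt }
    U⊆x : U ⊆ x
    U⊆x {v} _ with em {v ∈ x}
    ... | yes v∈x = v∈x
    ... | no v∉x = ⊥-elim (¬v∉x (v , v∉x))

  nonzero : 1 ≤ D → ∃[ w ] w ∈ x × ¬ w 𝒱.≈ᴹ 𝒱.0ᴹ
  nonzero 1≤D with em {∃[ w ] w ∈ x × ¬ w 𝒱.≈ᴹ 𝒱.0ᴹ}
  ... | yes w = w
  ... | no ¬w = ⊥-elim (ℕ.<⇒≱ 1≤D (dimension-mono (isx) x⊆0 (x-dim) 0-dim))
    where
    x⊆0 : x ⊆ (𝒱._≈ᴹ 𝒱.0ᴹ)
    x⊆0 {w} w∈x with em {w 𝒱.≈ᴹ 𝒱.0ᴹ}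
    ... | yes w≈0 = w≈0
    ... | no w≉0 = ⊥-elim (¬w (w , w∈x , w≉0))
    0-dim : HasDimension (𝒱._≈ᴹ 𝒱.0ᴹ) 0
    0-dim = (λ ()) , (λ ()) , (λ _ _ ()) , λ _ w≈0 → (λ ()) , w≈0

  [v+w]-w≈v : ∀ v w → (v 𝒱.+ᴹ w) 𝒱.+ᴹ (F.- F.1#) 𝒱.*ₗ w 𝒱.≈ᴹ v
  [v+w]-w≈v v w = begin
    (v 𝒱.+ᴹ w) 𝒱.+ᴹ (F.- F.1#) 𝒱.*ₗ w              ≈⟨ 𝒱.+ᴹ-assoc v w _ ⟩
    v 𝒱.+ᴹ (w 𝒱.+ᴹ (F.- F.1#) 𝒱.*ₗ w)              ≈⟨ 𝒱.+ᴹ-congˡ (𝒱.+ᴹ-congʳ (𝒱.*ₗ-identityˡ w)) ⟨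
    v 𝒱.+ᴹ (F.1# 𝒱.*ₗ w 𝒱.+ᴹ (F.- F.1#) 𝒱.*ₗ w)    ≈⟨ 𝒱.+ᴹ-congˡ (𝒱.*ₗ-distribʳ w F.1# (F.- F.1#)) ⟨
    v 𝒱.+ᴹ (F.1# F.+ F.- F.1#) 𝒱.*ₗ w              ≈⟨ 𝒱.+ᴹ-congˡ (𝒱.*ₗ-congʳ (F.-‿inverseʳ F.1#)) ⟩
    v 𝒱.+ᴹ F.0# 𝒱.*ₗ w                              ≈⟨ 𝒱.+ᴹ-congˡ (𝒱.*ₗ-zeroˡ w) ⟩
    v 𝒱.+ᴹ 𝒱.0ᴹ                                     ≈⟨ 𝒱.+ᴹ-identityʳ v ⟩
    v                                               ∎
    where open SetoidReasoning 𝒱.≈ᴹ-setoid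

  -- Take `v` outside `x` and a nonzero `w` in `x`: the lines are spanned by `v` and `v + w`. If
  -- `v + w` were a multiple of `v`, so would be `w`, and a multiple of `v` in `x` is zero.
  distinct-lines : 1 ≤ D → D < N → ∃₂ λ v v′ → v ∉ x × v′ ∉ x × ¬ Line v′ ⊆ Line v
  distinct-lines 1≤D D<N =
    let v , v∉x       = outside D<N
        w , w∈x , w≉0 = nonzero 1≤D
        v+w∉x v+w∈x   = v∉x (x.resp ([v+w]-w≈v v w) (x.+-closed v+w∈x (x.*-closed (F.- F.1#) w∈x)))
    in v , v 𝒱.+ᴹ w , v∉x , v+w∉x , λ ⊆Line → w≉0 (w≈0 v∉x w∈x (⊆Line (v∈Line (v 𝒱.+ᴹ w))))
    where
    w≈0 : ∀ {v w} → v ∉ x → w ∈ x → (v 𝒱.+ᴹ w) ∈ Line v → w 𝒱.≈ᴹ 𝒱.0ᴹ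
    w≈0 {v} {w} v∉x w∈x (a , v+w≈av) =
      𝒱.≈ᴹ-trans w≈ (𝒱.≈ᴹ-trans (𝒱.*ₗ-congʳ (scalar≈0 v∉x w≈ w∈x)) (𝒱.*ₗ-zeroˡ v))
      where
      open SetoidReasoning 𝒱.≈ᴹ-setoid
      w≈ : w 𝒱.≈ᴹ (a F.+ F.- F.1#) 𝒱.*ₗ v
      w≈ = begin
        w                                       ≈⟨ [v+w]-w≈v w v ⟨
        (w 𝒱.+ᴹ v) 𝒱.+ᴹ (F.- F.1#) 𝒱.*ₗ v       ≈⟨ 𝒱.+ᴹ-congʳ (𝒱.≈ᴹ-trans (𝒱.+ᴹ-comm w v) v+w≈av) ⟩
        a 𝒱.*ₗ v 𝒱.+ᴹ (F.- F.1#) 𝒱.*ₗ v         ≈⟨ 𝒱.*ₗ-distribʳ v a (F.- F.1#) ⟨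
        (a F.+ F.- F.1#) 𝒱.*ₗ v                 ∎

-- The grading of the subspace lattice by position relative to `x`.

module Geometry
  (em : ExcludedMiddle (lsuc 0ℓ)) (ℝ : CompleteOrderedField)
  (F : Field) {q : ℕ} (card : HasCardinality (Field.setoid F) q) (2≤q : 2 ≤ q)
  (𝒱 : FieldModule F) {N : ℕ} (dim𝒱 : HasDimension𝒱 F 𝒱 N)
  (D : ℕ) (x : Grassmann.X em ℝ F card 𝒱 dim𝒱 D)
  where
  open Grassmann em ℝ F card 𝒱 dim𝒱 D hiding (resp; 0-mem; add; scale; incl; HasDimension; IsSubspace)
  open At x
  open 𝒱-subspaces using (subspace-complete; subspaces; HasDimension; IsSubspace)
  open Dimension F card 2≤q 𝒱
  open TransversalLines (em₀ em) F card 2≤q 𝒱 dim𝒱 using (line∩x; line-dim; distinct-lines)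

  ⟦⟧-isSubspace : ∀ u → IsSubspace ⟦ u ⟧
  ⟦⟧-isSubspace u = proj₂ (lookup subspaces u)

  P-unique : ∀ {u i j i′ j′} → u ∈ P[ i , j ] → u ∈ P[ i′ , j′ ] → i ≡ i′ × j ≡ j′
  P-unique {u} {i} {j} {i′} {j′} (∩-i , i+j) (∩-i′ , i′+j′)
    with dimension-unique (∩-isSubspace (⟦⟧-isSubspace u) (⟦⟧-isSubspace (vertex x))) ∩-i ∩-i′
  ... | ≡.refl = ≡.refl , ℕ.+-cancelˡ-≡ i j j′ (dimension-unique (⟦⟧-isSubspace u) i+j i′+j′)

  line∈P[0,1] : ∀ {v} → v ∉ ⟦ vertex x ⟧ → ∃[ u ] u ∈ P[ 0 , 1 ] × ⟦ u ⟧ ≐ Line v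
  line∈P[0,1] {v} v∉x =
    let u , u⊆ , ⊆u = subspace-complete (Line v , line-isSubspace v)
    in u , ( dimension-≐ ((λ (p , p∈x) → ⊆u p , p∈x) , λ (p , p∈x) → u⊆ p , p∈x) (line∩x isx x-dim v∉x)
           , dimension-≐ (⊆u , u⊆) (line-dim isx x-dim v∉x)) , u⊆ , ⊆u
    where
    isx = ⟦⟧-isSubspace (vertex x)
    x-dim = vertex-HasDim x

  P[0,1]-distinct : 1 ≤ D → D < N → ∃₂ λ u v → u ∈ P[ 0 , 1 ] × v ∈ P[ 0 , 1 ] × u ≢ v
  P[0,1]-distinct 1≤D D<N =
    let v , v′ , v∉x , v′∉x , Line⊈ = distinct-lines (⟦⟧-isSubspace (vertex x)) (vertex-HasDim x) 1≤D D<N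
        u  , u∈  , u⊆ , _  = line∈P[0,1] v∉x
        u′ , u′∈ , _ , ⊆u′ = line∈P[0,1] v′∉x
    in u , u′ , u∈ , u′∈ , λ u≡u′ → Line⊈ λ {w} w∈ → u⊆ (≡.subst (λ t → w ∈ ⟦ t ⟧) (≡.sym u≡u′) (⊆u′ w∈))

  HasType-dim≤1 : ∀ {Ω α β ρ i j} → HasType Ω α β ρ → i ≤ D → j ≤ N ∸ D →
                  ∃[ d ] d ≤ 1 × ℂVec.HasDimension (Image E*[ i , j ] Ω) d
  HasType-dim≤1 {i = i} {j} t i≤D j≤N∸D = cases (em₀ em)
    where
    cases : Dec (HasType.InSupport t i j) → ∃[ d ] d ≤ 1 × ℂVec.HasDimension (Image E*[ i , j ] _) d
    cases (yes p) = 1 , ℕ.≤-refl , HasType.dim-one t i j i≤D j≤N∸D p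
    cases (no ¬p) = 0 , z≤n , HasType.dim-zero t i j i≤D j≤N∸D ¬p

  -- A type bounds the dimension at `(0 , 1)` by 1 whether or not that position lies in its support,
  -- so the argument is uniform in `α`, `β` and `ρ`.
  full⇒¬HasType : 1 ≤ D → 1 ≤ N ∸ D → D < N → ∀ {Ω α β ρ} → (∀ ψ → ψ ∈ Ω) → ¬ HasType Ω α β ρ
  full⇒¬HasType 1≤D 1≤N∸D D<N {Ω} full t =
    let u , v , u∈ , v∈ , u≢v = P[0,1]-distinct 1≤D D<N
        d , d≤1 , dim = HasType-dim≤1 t z≤n 1≤N∸D
    in units-dim>1 (unit-mem {Ω} full u∈) (unit-mem {Ω} full v∈) u≢v dim d≤1
    where open GradedModules em ℝ vertex vertex-injective P[_,_] P-unique D (N ∸ D)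

lemma6p8 : (em : ExcludedMiddle (lsuc 0ℓ)) (ℝ : CompleteOrderedField)
    (D N q : ℕ) → 1 ≤ D → 2 ℕ.* D < N → IsPrimePower q →
    (F : Field) (card : HasCardinality (Field.setoid F) q)
    (𝒱 : FieldModule F) (dim𝒱 : HasDimension𝒱 F 𝒱 N) →
    let open Grassmann em ℝ F card 𝒱 dim𝒱 D in
    (x : X) →
    let open At x in
    (W : Pred V 0ℓ) → IsIrreducibleT W → W ⊆ Nucleus →
    (r : ℕ) → IsEndpoint W r →
    (Ω : Pred Ψ 0ℓ) → IsIrreducibleℋ Ω → IsAlphaDominant Ω r →
    (tilde Ω ≐ W) ⇔ (Ω ≐ (W ^ℋ))
lemma6p8 em ℝ D N q 1≤D 2D<N q-primePower F card 𝒱 dim𝒱 x W W-irreducible _ r _ Ω Ω-irreducible Ω-type =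
  mk⇔ (tilde≐⇒≐^ℋ D≤N∸D (IsIrreducible.nonzero W-irreducible) Ω-irreducible) (^ℋ⇒tilde em)
  where
  open Grassmann em ℝ F card 𝒱 dim𝒱 D
  open At x
  2≤q = primePower≥2 q-primePower
  1≤√q = OrderedFieldProperties.1≤√ ℝ (ℕ.<⇒≤ 2≤q)
  open Geometry em ℝ F card 2≤q 𝒱 dim𝒱 D x using (P-unique; full⇒¬HasType)
  open GradedModules em ℝ vertex vertex-injective P[_,_] P-unique D (N ∸ D) using (module Stable)
  open Stable (CompleteOrderedField.√ ℝ q) 1≤√q (OrderedFieldProperties.√≉1 ℝ 2≤q)
    (+ D) (+ N ℤ.- + D) ℋ (gen K₁-gen) (gen K₂-gen) using (tilde≐⇒≐^ℋ; ^ℋ≐⇒tilde≐)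

  D+D<N : D ℕ.+ D < N
  D+D<N = ≡.subst (λ m → D ℕ.+ m < N) (ℕ.+-identityʳ D) 2D<N

  D≤N∸D : D ≤ N ∸ D
  D≤N∸D = ℕ.m+n≤o⇒m≤o∸n D (ℕ.<⇒≤ D+D<N)

  -- Existence of a competitor quantifies over predicates, so deciding it takes excluded middle at
  -- level `lsuc 0ℓ`.
  ^ℋ⇒tilde : Dec (∃[ Ω₀ ] IsModule ℋ Ω₀ × tilde Ω₀ ≐ W) → Ω ≐ (W ^ℋ) → tilde Ω ≐ W
  ^ℋ⇒tilde (yes (Ω₀ , Ω₀-module , Ω̃₀≐W)) Ω≐W^ℋ = ^ℋ≐⇒tilde≐ D≤N∸D Ω₀-module Ω̃₀≐W Ω≐W^ℋ
  ^ℋ⇒tilde (no none) Ω≐W^ℋ = ⊥-elim (full⇒¬HasType 1≤D (ℕ.≤-trans 1≤D D≤N∸D) (ℕ.≤-<-trans (ℕ.m≤m+n D D) D+D<N)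
    (λ ψ → proj₂ Ω≐W^ℋ λ Ω′ Ω′-module Ω̃′≐W → ⊥-elim (none (Ω′ , Ω′-module , Ω̃′≐W))) Ω-type)
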